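{- With $$a=c=h=r=q,\qquad b=f=d=\ell=t=q^2,\qquad g=w=0,\qquad p=u=1,\qquad s=2q,$$ one has $$\mathcal C(z)=\sum_{n\ge0}\sum_{\pi\in\mathcal S_n}q^{\mathsf{inv}(\pi)}z^n .$$ If, in addition, $z$ is replaced by $z((k-1)q+1)$, then $\mathcal C$ gives the distribution of inversions over the $k$-colored permutations for $k>1$: with the same parameter values, $$\mathcal C\bigl(z((k-1)q+1)\bigr)=\sum_{n\ge0}\sum_{P\in\mathcal S_n^k}q^{\mathsf{inv}(P)}z^n .$$
   Context: $\mathcal S_n$ is the set of permutations of $[n]=\{1,\dots,n\}$; for $\pi\in\mathcal S_n$, $\mathsf{inv}(\pi)$ is the number of pairs $i<j$ in $[n]$ with $\pi(i)>\pi(j)$. A $k$-colored permutation of $[n]$ is a pair $P=(a_1\ldots a_n,\ c_1\ldots c_n)$ where $a_1\ldots a_n$ is a permutation of $[n]$ and each $c_i\in\{0,1,\dots,k-1\}$; the set of these is $\mathcal S_n^k$. One declares $a_{n+1}=n+1$ and $c_{n+1}=0$, and orders pairs by $(a_i,c_i)>(a_j,c_j)$ if $c_i>c_j$, or $c_i=c_j$ and $a_i>a_j$. For $P\in\mathcal S_n^k$, $\mathsf{inv}(P)$ is the number of pairs $(i,j)$ with $1\le i<j\le n+1$ and $(a_i,c_i)>(a_j,c_j)$. For $n\ge1$, $[n]_{x,y}:=\sum_{i=0}^{n-1}x^{n-1-i}y^{i}$, and $[0]_{x,y}:=0$, with the convention $0^0=1$. For parameters $a,b,c,d,f,g,h,\ell,p,r,s,t,u,w$,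 $\mathcal C(z)$ is the formal power series in $z$ defined by the continued fraction $$\mathcal C(z)=\cfrac{1}{1-\alpha_0z-\cfrac{\beta_1z^2}{1-\alpha_1z-\cfrac{\beta_2z^2}{\ddots}}},\qquad \alpha_n=u\,w^n+s\,[n]_{a,b}+t\,[n]_{f,g}\ (n\ge 0),\quad \beta_n=p\,r\,[n]_{c,d}\,[n]_{h,\ell}\ (n\ge 1).$$ -}

module Defs where

open import Algebra.Bundles using (CommutativeRing)
open import Data.Fin.Base as Fin using (Fin; toℕ)
import Data.Fin.Properties as Fin
open import Data.List.Base as List
  using (List; allFin; cartesianProduct; cartesianProductWith; filter; length)
open import Data.Nat.Base as ℕ using (ℕ; zero; suc; _∸_; z≤n; s≤s)
import Data.Nat.Properties as ℕ
open import Data.Product.Base using (_×_; _,_)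
open import Data.Sum.Base using (_⊎_)
open import Data.Vec.Base as Vec using (Vec; lookup; _∷ʳ_)
import Data.Vec.Functional as Vector
open import Function.Definitions using (Bijective; Injective; Surjective)
open import Level as Level using (Level)
open import Relation.Binary.Core using (Rel)
open import Relation.Binary.Definitions using (Decidable)
open import Relation.Binary.PropositionalEquality.Core as ≡ using (_≡_)
open import Relation.Nullary.Decidable using (Dec; map′; _×-dec_; _⊎-dec_; _→-dec_)

------------------------------------------------------------------------
-- Permutations, coloured permutations and their inversions

module _ {a ℓ : Level} {A : Set a} {_>_ : Rel A ℓ} where

  inversions : Decidable _>_ → ∀ {m} → Vec A m → ℕ
  inversions _>?_ {m} x =
    length (filter (λ (i , j) → (i Fin.<? j) ×-dec (lookup x i >? lookup x j))
                   (cartesianProduct (allFin m) (allFin m)))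

-- All words of length n over the alphabet Fin k, each listed once.
words : ∀ k n → List (Vec (Fin k) n)
words k zero    = List.[ Vec.[] ]
words k (suc n) = cartesianProductWith Vec._∷_ (allFin k) (words k n)

-- Permutations in one-line notation; [n] is represented by Fin n, i.e.
-- positions and letters are shifted down by one.
IsPermutation : ∀ {n} → Vec (Fin n) n → Set
IsPermutation π = Bijective _≡_ _≡_ (lookup π)

isPermutation? : ∀ {n} (π : Vec (Fin n) n) → Dec (IsPermutation π)
isPermutation? π = injective? ×-dec surjective?
  where
  injective? : Dec (Injective _≡_ _≡_ (lookup π))
  injective? = map′ (λ h {i} {j} → h i j) (λ h i j → h)
    (Fin.all? λ i → Fin.all? λ j →
      (lookup π i Fin.≟ lookup π j) →-dec (i Fin.≟ j))

  surjective? : Dec (Surjective _≡_ _≡_ (lookup π))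
  surjective? = Fin.all? λ j → Fin.any? λ i →
    map′ (λ { eq ≡.refl → eq }) (λ h → h ≡.refl) (lookup π i Fin.≟ j)

𝒮 : ∀ n → List (Vec (Fin n) n)
𝒮 n = filter isPermutation? (words n n)

inv : ∀ {n} → Vec (Fin n) n → ℕ
inv = inversions (λ x y → y Fin.<? x)

ColoredPermutation : ℕ → ℕ → Set
ColoredPermutation k n = Vec (Fin n) n × Vec (Fin k) n

𝒮ᶜ : ∀ k n → List (ColoredPermutation k n)
𝒮ᶜ k n = cartesianProduct (𝒮 n) (words k n)

_≻_ : Rel (ℕ × ℕ) Level.zero
(a , c) ≻ (a′ , c′) = c ℕ.> c′ ⊎ (c ≡ c′ × a ℕ.> a′)

_≻?_ : Decidable _≻_
(a , c) ≻? (a′ , c′) = (c′ ℕ.<? c) ⊎-dec ((c ℕ.≟ c′) ×-dec (a′ ℕ.<? a))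

-- The appended pair is (a₍ₙ₊₁₎ , c₍ₙ₊₁₎) = (n + 1 , 0), with its letter
-- shifted down by one like all others.
invᶜ : ∀ {k n} → ColoredPermutation k n → ℕ
invᶜ {n = n} (a , c) =
  inversions _≻?_ (Vec.zip (Vec.map toℕ a) (Vec.map toℕ c) ∷ʳ (n , 0))

------------------------------------------------------------------------
-- Formal power series and continued fractions over a commutative ring

module OverRing {c₀ ℓ₀ : Level} (R : CommutativeRing c₀ ℓ₀) where

  open CommutativeRing R hiding (zero)
  open import Algebra.Properties.Semiring.Exp semiring public using (_^_)
  open import Algebra.Properties.Monoid.Mult +-monoid public
    using () renaming (_×_ to _·_)
  open import Algebra.Properties.CommutativeMonoid.Sum +-commutativeMonoid
    using (sum; sum-syntax; sum-cong-≋)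
  open import Algebra.Properties.Ring ring using (-0#≈0#)
  open import Relation.Binary.Reasoning.Setoid setoid

  ∑[_] : ∀ {a} {A : Set a} → List A → (A → Carrier) → Carrier
  ∑[ xs ] f = List.foldr (λ x acc → f x + acc) 0# xs

  -- f n is the coefficient of zⁿ.
  Series : Set c₀
  Series = ℕ → Carrier

  infix  4 _≐_
  infixl 6 _⊖_
  infixl 7 _⊛_
  infixr 7 _•_
  infixr 8 z·_

  _≐_ : Series → Series → Set ℓ₀
  f ≐ g = ∀ n → f n ≈ g n

  one : Series
  one zero    = 1#
  one (suc n) = 0#

  _⊖_ : Series → Series → Series
  (f ⊖ g) n = f n - g n

  _•_ : Carrier → Series → Series
  (x • f) n = x * f n

  z·_ : Series → Series
  (z· f) zero    = 0#
  (z· f) (suc n) = f n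

  _⊛_ : Series → Series → Series
  (f ⊛ g) n = ∑[ i < suc n ] (f (toℕ i) * g (n ∸ toℕ i))

  -- The substitution z ↦ x z.
  dilate : Carrier → Series → Series
  dilate x f n = x ^ n * f n

  -- The first n + 1 coefficients of 1 / f, highest degree first, for f
  -- with constant coefficient 1; see ⊛-recip.
  recipCoeffs : Series → ∀ n → Vector.Vector Carrier (suc n)
  recipCoeffs f zero    = λ _ → 1#
  recipCoeffs f (suc n) =
    (- (∑[ i < suc n ] (f (suc (toℕ i)) * recipCoeffs f n i)))
      Vector.∷ recipCoeffs f n

  recip : Series → Series
  recip f n = recipCoeffs f n Fin.zero

  recipCoeffs≈recip : ∀ f n i → recipCoeffs f n i ≈ recip f (n ∸ toℕ i)
  recipCoeffs≈recip f zero    Fin.zero    = refl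
  recipCoeffs≈recip f (suc n) Fin.zero    = refl
  recipCoeffs≈recip f (suc n) (Fin.suc i) = recipCoeffs≈recip f n i

  ⊛-recip : ∀ f → f 0 ≈ 1# → f ⊛ recip f ≐ one
  ⊛-recip f f₀≈1 zero = begin
    f 0 * 1# + 0#  ≈⟨ +-identityʳ _ ⟩
    f 0 * 1#       ≈⟨ *-identityʳ _ ⟩
    f 0            ≈⟨ f₀≈1 ⟩
    1#             ∎
  ⊛-recip f f₀≈1 (suc n) = begin
    f 0 * - S + ∑[ i < suc n ] (f (suc (toℕ i)) * recip f (n ∸ toℕ i))
      ≈⟨ +-cong (*-congʳ f₀≈1)
                (sum-cong-≋ {suc n} λ i → *-congˡ {f (suc (toℕ i))} (sym (recipCoeffs≈recip f n i))) ⟩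
    1# * - S + S  ≈⟨ +-congʳ (*-identityˡ _) ⟩
    - S + S       ≈⟨ -‿inverseˡ S ⟩
    0#            ∎
    where S = ∑[ i < suc n ] (f (suc (toℕ i)) * recipCoeffs f n i)

  -- The J-fraction with coefficients α₀, α₁, … and β₁, β₂, … (β 0 is
  -- not used).
  module JFraction (α β : ℕ → Carrier) where

    -- convergent m i is the part of the fraction from level i down to
    -- level i + m, with everything below dropped.
    denominator : ℕ → ℕ → Series
    convergent  : ℕ → ℕ → Series

    denominator zero    i = one ⊖ α i • z· one
    denominator (suc m) i =
      one ⊖ α i • z· one ⊖ β (suc i) • z· z· convergent m (suc i)

    convergent m i = recip (denominator m i)

    -- The limit of the convergents in the z-adic topology; see
    -- convergent-limit.
    jFraction : Series
    jFraction n = convergent n 0 n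

    private
      x-y*0≈x : ∀ x y → x - y * 0# ≈ x
      x-y*0≈x x y = begin
        x - y * 0#  ≈⟨ +-congˡ (-‿cong (zeroʳ y)) ⟩
        x - 0#      ≈⟨ +-congˡ -0#≈0# ⟩
        x + 0#      ≈⟨ +-identityʳ x ⟩
        x           ∎

      denominator₀ : ∀ m i → denominator m i 0 ≈ 1#
      denominator₀ zero    i = x-y*0≈x _ _
      denominator₀ (suc m) i = trans (x-y*0≈x _ _) (x-y*0≈x _ _)

      recipCoeffs-cong : ∀ {f g} N → (∀ n → n ℕ.≤ N → f n ≈ g n) →
                         ∀ i → recipCoeffs f N i ≈ recipCoeffs g N i
      recipCoeffs-cong zero    f≈g i        = refl
      recipCoeffs-cong (suc N) f≈g Fin.zero =
        -‿cong (sum-cong-≋ {suc N} λ i →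
          *-cong (f≈g _ (Fin.toℕ<n i))
                 (recipCoeffs-cong N (λ n n≤N → f≈g n (ℕ.m≤n⇒m≤1+n n≤N)) i))
      recipCoeffs-cong (suc N) f≈g (Fin.suc i) =
        recipCoeffs-cong N (λ n n≤N → f≈g n (ℕ.m≤n⇒m≤1+n n≤N)) i

      denominator-stable : ∀ {m m′} i {n} → n ℕ.≤ m → m ℕ.≤ m′ →
                           denominator m i n ≈ denominator m′ i n
      convergent-stable  : ∀ {m m′} i {n} → n ℕ.≤ m → m ℕ.≤ m′ →
                           convergent m i n ≈ convergent m′ i n

      denominator-stable {m} {m′} i {zero} _ _ =
        trans (denominator₀ m i) (sym (denominator₀ m′ i))
      denominator-stable i {suc zero}    (s≤s _) (s≤s _) = refl
      denominator-stable i {suc (suc n)} (s≤s n<m) (s≤s m≤m′) =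
        +-congˡ (-‿cong (*-congˡ
          (convergent-stable (suc i) (ℕ.<⇒≤ n<m) m≤m′)))

      convergent-stable i {n} n≤m m≤m′ = recipCoeffs-cong n
        (λ j j≤n → denominator-stable i (ℕ.≤-trans j≤n n≤m) m≤m′) Fin.zero

    denominator⊛convergent : ∀ m i → denominator m i ⊛ convergent m i ≐ one
    denominator⊛convergent m i = ⊛-recip (denominator m i) (denominator₀ m i)

    convergent-limit : ∀ n m → n ℕ.≤ m → convergent m 0 n ≈ jFraction n
    convergent-limit n m n≤m = sym (convergent-stable 0 ℕ.≤-refl n≤m)

  [_]⟨_,_⟩ : ℕ → Carrier → Carrier → Carrier
  [ n ]⟨ x , y ⟩ = ∑[ i < n ] (x ^ (n ∸ 1 ∸ toℕ i) * y ^ toℕ i)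

  record Parameters : Set c₀ where
    field a b c d f g h ℓ p r s t u w : Carrier

  module _ (P : Parameters) where
    open Parameters P

    α β : ℕ → Carrier
    α n = u * w ^ n + s * [ n ]⟨ a , b ⟩ + t * [ n ]⟨ f , g ⟩
    β n = p * r * [ n ]⟨ c , d ⟩ * [ n ]⟨ h , ℓ ⟩

    𝒞 : Series
    𝒞 = JFraction.jFraction α β

  inversionParameters : Carrier → Parameters
  inversionParameters q = record
    { a = q ; c = q ; h = q ; r = q
    ; b = q ^ 2 ; f = q ^ 2 ; d = q ^ 2 ; ℓ = q ^ 2 ; t = q ^ 2
    ; g = 0# ; w = 0#
    ; p = 1# ; u = 1#
    ; s = 2 · q
    }

{-# OPTIONS --safe #-}
-- Both sides of the first identity have coefficients [n]_q!.  For the fraction, it is enough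
-- to exhibit power series G₀ = 1, G₁, G₂, … with constant term 1 and
--   Gᵢ = Gᵢ₊₁ - αᵢ z Gᵢ₊₁ - βᵢ₊₁ z² Gᵢ₊₂,
-- because then the tail of the fraction at level i is Gᵢ₊₁ / Gᵢ.  The series
--   Gᵢ₊₁ = ∑ₙ [n]_q! [n+i choose i]_q² zⁿ
-- satisfy it: the J-fraction is the even contraction of an S-fraction, whose simpler two-term
-- recurrences follow from [n+1] [n+1+i choose i] = [i+1] [n+1+i choose i+1].
--
-- For the permutations, inserting the letters in decreasing order multiplies the inversion
-- generating function by [1], [2], …, [n], for any total order on the letters.  For coloured
-- permutations, attach the colours to the letters instead of the positions: for a fixed
-- colouring of the letters the pairs are totally ordered, so the permutations contribute
-- [n]_q!, and the inversions with the appended pair (n+1, 0) count the nonzero colours, which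
-- gives the factor ((k-1) q + 1)ⁿ.
module Submission where

open import Defs
open import Algebra.Bundles using (CommutativeRing)
open import Data.Nat.Base using (ℕ; _∸_; _<_)
open import Data.Product.Base using (_×_)

open import Data.Bool.Base using (true; false; if_then_else_)
open import Data.Fin.Base as Fin using (Fin; zero; suc; toℕ)
import Data.Fin.Properties as Fin
open import Data.List.Base as List
  using (List; []; _∷_; _++_; allFin; cartesianProduct; cartesianProductWith; filter; length)
import Data.List.Properties as List
open import Data.List.Membership.Propositional using (_∈_; _∉_)
open import Data.List.Membership.Propositional.Properties
open import Data.List.Membership.Propositional.Properties.WithK using (unique∧set⇒bag)
open import Data.List.Relation.Binary.BagAndSetEquality using (∼bag⇒↭)
open import Data.List.Relation.Binary.Permutation.Propositional as Perm
  using (_↭_; ↭-sym; ↭-trans; ↭-refl; ↭⇒↭ₛ)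
open import Data.List.Relation.Binary.Permutation.Propositional.Properties
  using (∈-resp-↭; All-resp-↭; filter-↭; ↭-length; drop-∷)
import Data.List.Relation.Binary.Permutation.Setoid.Properties as SetoidPerm
open import Data.List.Relation.Unary.All as All using (All; []; _∷_)
open import Data.List.Relation.Unary.AllPairs as AllPairs using (AllPairs; []; _∷_)
open import Data.List.Relation.Unary.Any using (here; there)
open import Data.List.Relation.Unary.Unique.Propositional using (Unique)
import Data.List.Relation.Unary.Unique.Propositional.Properties as Unique
open import Data.Nat.Base as ℕ using (zero; suc; _≤_; z≤n; s≤s)
import Data.Nat.ListAction as ListAction
import Data.Nat.Properties as ℕ
open import Data.Nat.Solver using (module +-*-Solver)
open import Data.Product.Base as Product using (_,_; ∃; ∃₂; proj₁; proj₂)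
open import Data.Product.Relation.Binary.Lex.Strict using (×-strictTotalOrder)
open import Data.Sum.Base using (_⊎_; inj₁; inj₂)
open import Data.Vec.Base as Vec using (Vec; []; _∷_; lookup; toList; insertAt; _∷ʳ_)
import Data.Vec.Membership.Propositional.Properties as Vec
import Data.Vec.Properties as Vec
import Data.Vec.Relation.Unary.Any as VecAny
import Data.Vec.Relation.Unary.Any.Properties as VecAny
open import Function.Base using (_∘_; id)
open import Function.Bundles using (mk⇔)
open import Level using (Level)
open import Relation.Binary.Bundles using (StrictTotalOrder)
import Relation.Binary.Construct.On as On
open import Relation.Binary.Core using (Rel)
import Relation.Binary.Definitions as B
import Relation.Binary.PropositionalEquality as ≡
open import Relation.Binary.PropositionalEquality using (_≡_; _≢_)
open import Relation.Nullary using (¬_; does; contradiction; _×-dec_)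
open import Relation.Nullary.Decidable using (does-⇔)
open import Relation.Unary using (Pred; Decidable)

-- Power series and J-fractions

module CauchyProduct {c₀ ℓ₀} (R : CommutativeRing c₀ ℓ₀) where
  open CommutativeRing R hiding (zero)
  open OverRing R
  open import Algebra.Properties.Group +-group using () renaming (∙-cancelʳ to +-cancelʳ)
  open import Relation.Binary.Reasoning.Setoid setoid
  open import Algebra.Solver.Ring.NaturalCoefficients.Default commutativeSemiring
    using (solve; _:=_; _:+_; _:*_; con)

  -- Cauchy products and agreement up to a fixed degree.

  infix 4 _≐[_]_
  -- A convergent fixes only finitely many coefficients, so identities involving it are stated
  -- modulo `z^(N+1)`.
  _≐[_]_ : Series → ℕ → Series → Set ℓ₀
  f ≐[ N ] g = ∀ n → n ≤ N → f n ≈ g n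

  infixl 6 _⊕_
  _⊕_ : Series → Series → Series
  (f ⊕ g) n = f n + g n

  -- The coefficient `(f ⊛ g) (suc n)` unfolds to `f 0 * g (suc n) + ((f ∘ suc) ⊛ g) n`. Most
  -- product laws below are therefore inductions on the degree in which the left factor is replaced
  -- by its shift.
  ⊛-congˡ : ∀ {N} f {g h} → g ≐[ N ] h → f ⊛ g ≐[ N ] f ⊛ h
  ⊛-congˡ f g≐h zero n≤N = +-congʳ (*-congˡ (g≐h 0 n≤N))
  ⊛-congˡ f g≐h (suc n) n<N =
    +-cong (*-congˡ (g≐h (suc n) n<N))
      (⊛-congˡ (f ∘ suc) (λ m m≤n → g≐h m (ℕ.≤-trans m≤n (ℕ.<⇒≤ n<N))) n ℕ.≤-refl)

  ⊛-congʳ : ∀ {N f g} h → f ≐[ N ] g → f ⊛ h ≐[ N ] g ⊛ h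
  ⊛-congʳ h f≐g zero n≤N = +-congʳ (*-congʳ (f≐g 0 n≤N))
  ⊛-congʳ {suc N} h f≐g (suc n) n<N =
    +-cong (*-congʳ (f≐g 0 z≤n))
      (⊛-congʳ h (λ m m≤n → f≐g (suc m) (s≤s m≤n)) n (ℕ.s≤s⁻¹ n<N))

  ⊛-distribʳ-⊕ : ∀ h f g → (f ⊕ g) ⊛ h ≐ f ⊛ h ⊕ g ⊛ h
  ⊛-distribʳ-⊕ h f g zero =
    solve 3 (λ a b c → (a :+ b) :* c :+ con 0 := (a :* c :+ con 0) :+ (b :* c :+ con 0)) refl
      (f 0) (g 0) (h 0)
  ⊛-distribʳ-⊕ h f g (suc n) = trans
    (+-congˡ (⊛-distribʳ-⊕ h (f ∘ suc) (g ∘ suc) n))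
    (solve 5 (λ a b c x y → (a :+ b) :* c :+ (x :+ y) := (a :* c :+ x) :+ (b :* c :+ y)) refl
      (f 0) (g 0) (h (suc n)) _ _)

  ⊛-distribˡ-⊕ : ∀ f g h → f ⊛ (g ⊕ h) ≐ f ⊛ g ⊕ f ⊛ h
  ⊛-distribˡ-⊕ f g h zero =
    solve 3 (λ a b c → c :* (a :+ b) :+ con 0 := (c :* a :+ con 0) :+ (c :* b :+ con 0)) refl
      (g 0) (h 0) (f 0)
  ⊛-distribˡ-⊕ f g h (suc n) = trans
    (+-congˡ (⊛-distribˡ-⊕ (f ∘ suc) g h n))
    (solve 5 (λ a b c x y → c :* (a :+ b) :+ (x :+ y) := (c :* a :+ x) :+ (c :* b :+ y)) refl
      (g (suc n)) (h (suc n)) (f 0) _ _)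

  •-⊛ : ∀ x f g → (x • f) ⊛ g ≐ x • (f ⊛ g)
  •-⊛ x f g zero =
    solve 3 (λ x a b → x :* a :* b :+ con 0 := x :* (a :* b :+ con 0)) refl x (f 0) (g 0)
  •-⊛ x f g (suc n) = trans
    (+-congˡ (•-⊛ x (f ∘ suc) g n))
    (solve 4 (λ x a b y → x :* a :* b :+ x :* y := x :* (a :* b :+ y)) refl x (f 0) (g (suc n)) _)

  ⊛-• : ∀ x f g → f ⊛ (x • g) ≐ x • (f ⊛ g)
  ⊛-• x f g zero =
    solve 3 (λ x a b → a :* (x :* b) :+ con 0 := x :* (a :* b :+ con 0)) refl x (f 0) (g 0)
  ⊛-• x f g (suc n) = trans
    (+-congˡ (⊛-• x (f ∘ suc) g n))
    (solve 4 (λ x a b y → a :* (x :* b) :+ x :* y := x :* (a :* b :+ y)) refl x (f 0) (g (suc n)) _)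

  ⊛-z· : ∀ f g → f ⊛ (z· g) ≐ z· (f ⊛ g)
  ⊛-z· f g zero = trans (+-identityʳ _) (zeroʳ _)
  ⊛-z· f g (suc zero) = +-congˡ (⊛-z· (f ∘ suc) g 0)
  ⊛-z· f g (suc (suc n)) = +-congˡ (⊛-z· (f ∘ suc) g (suc n))

  ⊛-identityʳ : ∀ f → f ⊛ one ≐ f
  ⊛-identityʳ f zero = trans (+-identityʳ _) (*-identityʳ _)
  ⊛-identityʳ f (suc n) =
    trans (+-cong (zeroʳ _) (⊛-identityʳ (f ∘ suc) n)) (+-identityˡ _)

  ⊛-zeroˡ : ∀ f → (λ _ → 0#) ⊛ f ≐ (λ _ → 0#)
  ⊛-zeroˡ f zero = trans (+-identityʳ _) (zeroˡ _)
  ⊛-zeroˡ f (suc n) = trans (+-cong (zeroˡ _) (⊛-zeroˡ f n)) (+-identityˡ _)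

  ⊛-identityˡ : ∀ f → one ⊛ f ≐ f
  ⊛-identityˡ f zero = trans (+-identityʳ _) (*-identityˡ _)
  ⊛-identityˡ f (suc n) =
    trans (+-cong (*-identityˡ _) (⊛-zeroˡ f n)) (+-identityʳ _)

  ⊛-assoc : ∀ f g h → (f ⊛ g) ⊛ h ≐ f ⊛ (g ⊛ h)
  ⊛-assoc f g h zero =
    solve 3 (λ a b c → (a :* b :+ con 0) :* c :+ con 0 := a :* (b :* c :+ con 0) :+ con 0) refl
      (f 0) (g 0) (h 0)
  ⊛-assoc f g h (suc n) = begin
    -- The shift of `f ⊛ g` is `f 0 • (g ∘ suc) ⊕ (f ∘ suc) ⊛ g`; distributing over this sum leaves
    -- the induction hypothesis for `f ∘ suc`.
    (f 0 * g 0 + 0#) * h (suc n) + ((f 0 • (g ∘ suc) ⊕ (f ∘ suc) ⊛ g) ⊛ h) n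
      ≈⟨ +-cong (*-congʳ (+-identityʳ _)) (⊛-distribʳ-⊕ h (f 0 • (g ∘ suc)) ((f ∘ suc) ⊛ g) n) ⟩
    f 0 * g 0 * h (suc n) + (((f 0 • (g ∘ suc)) ⊛ h) n + (((f ∘ suc) ⊛ g) ⊛ h) n)
      ≈⟨ +-congˡ (+-cong (•-⊛ (f 0) (g ∘ suc) h n) (⊛-assoc (f ∘ suc) g h n)) ⟩
    f 0 * g 0 * h (suc n) + (f 0 * ((g ∘ suc) ⊛ h) n + ((f ∘ suc) ⊛ (g ⊛ h)) n)
      ≈⟨ solve 5 (λ a b c x y → a :* b :* c :+ (a :* x :+ y) := a :* (b :* c :+ x) :+ y) refl
           (f 0) (g 0) (h (suc n)) _ _ ⟩
    f 0 * (g ⊛ h) (suc n) + ((f ∘ suc) ⊛ (g ⊛ h)) n ∎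

  -- G-rec and denominator-step have their subtracted terms moved to the other side, so that
  -- only semiring identities are needed.
  module _ (α β : ℕ → Carrier) (G : ℕ → Series)
           (G₀ : G 0 ≐ one) (G-const : ∀ i → G i 0 ≈ 1#)
           (G-rec : ∀ i → G i ⊕ (α i • z· G (suc i) ⊕ β (suc i) • z· z· G (suc (suc i)))
                          ≐ G (suc i)) where
    open JFraction α β

    private
      x-y-z : ∀ x y z → (x - y - z) + (y + z) ≈ x
      x-y-z x y z = begin
        (x - y - z) + (y + z)
          ≈⟨ solve 5 (λ x y y′ z z′ → (x :+ y′ :+ z′) :+ (y :+ z) := x :+ (y :+ y′) :+ (z :+ z′))
               refl x y (- y) z (- z) ⟩
        x + (y - y) + (z - z)  ≈⟨ +-cong (+-congˡ (-‿inverseʳ y)) (-‿inverseʳ z) ⟩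
        x + 0# + 0#            ≈⟨ trans (+-identityʳ _) (+-identityʳ _) ⟩
        x                      ∎

    denominator-step : ∀ m i →
      denominator (suc m) i ⊕ (α i • z· one ⊕ β (suc i) • z· z· convergent m (suc i)) ≐ one
    denominator-step m i n = x-y-z _ _ _

    z·-cong : ∀ {N f g} → f ≐[ N ] g → z· f ≐[ suc N ] z· g
    z·-cong f≐g zero    _     = refl
    z·-cong f≐g (suc n) n<N = f≐g n (ℕ.s≤s⁻¹ n<N)

    -- Mutual induction on the depth. `⊛-denominator` rests on `⊛-convergent` one level down, where
    -- the convergent stands behind `z²`; `⊛-convergent` then replaces `G i` by `G (suc i)` times
    -- the denominator, which cancels the convergent. Each further level of depth secures one more
    -- degree.
    ⊛-convergent : ∀ m i → G i ⊛ convergent m i ≐[ m ] G (suc i)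
    ⊛-denominator : ∀ m i → G (suc i) ⊛ denominator (suc m) i ≐[ suc m ] G i

    -- The subtracted terms, multiplied by `G₁`, form `X`. Adding `X` turns the left side into `G₁`
    -- by `denominator-step` and the right side into `G₁` by the recurrence; then `X` is cancelled.
    ⊛-denominator m i n n≤ = +-cancelʳ (X n) _ _ (begin
      (G₁ ⊛ denominator (suc m) i) n + X n
        ≈⟨ +-congˡ (+-cong (*-congˡ (G⊛z n)) (*-congˡ (G⊛zzC n n≤))) ⟨
      (G₁ ⊛ denominator (suc m) i) n
        + (α i * (G₁ ⊛ z· one) n + β (suc i) * (G₁ ⊛ z· z· C) n)
        ≈⟨ +-congˡ (+-cong (⊛-• (α i) G₁ (z· one) n) (⊛-• (β (suc i)) G₁ (z· z· C) n)) ⟨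
      (G₁ ⊛ denominator (suc m) i) n
        + ((G₁ ⊛ (α i • z· one)) n + (G₁ ⊛ (β (suc i) • z· z· C)) n)
        ≈⟨ +-congˡ (⊛-distribˡ-⊕ G₁ (α i • z· one) (β (suc i) • z· z· C) n) ⟨
      (G₁ ⊛ denominator (suc m) i) n + (G₁ ⊛ (α i • z· one ⊕ β (suc i) • z· z· C)) n
        ≈⟨ ⊛-distribˡ-⊕ G₁ (denominator (suc m) i) (α i • z· one ⊕ β (suc i) • z· z· C) n ⟨
      (G₁ ⊛ (denominator (suc m) i ⊕ (α i • z· one ⊕ β (suc i) • z· z· C))) n
        ≈⟨ ⊛-congˡ {n} G₁ (λ j _ → denominator-step m i j) n ℕ.≤-refl ⟩
      (G₁ ⊛ one) n
        ≈⟨ ⊛-identityʳ G₁ n ⟩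
      G₁ n
        ≈⟨ G-rec i n ⟨
      G i n + X n ∎)
      where
      G₁ = G (suc i)
      C = convergent m (suc i)
      X : Series
      X = α i • z· G₁ ⊕ β (suc i) • z· z· G (suc (suc i))
      G⊛z : G₁ ⊛ z· one ≐ z· G₁
      G⊛z n = trans (⊛-z· G₁ one n) (z·-cong {n} (λ j _ → ⊛-identityʳ G₁ j) n (ℕ.n≤1+n n))
      G⊛zzC : G₁ ⊛ z· z· C ≐[ suc m ] z· z· G (suc (suc i))
      G⊛zzC n n≤ = begin
        (G₁ ⊛ z· z· C) n  ≈⟨ ⊛-z· G₁ (z· C) n ⟩
        (z· (G₁ ⊛ z· C)) n ≈⟨ z·-cong {n} (λ j _ → ⊛-z· G₁ C j) n (ℕ.n≤1+n n) ⟩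
        -- Two factors `z` raise the order of agreement from `m` to `m + 2`, one more than is
        -- needed.
        (z· z· (G₁ ⊛ C)) n ≈⟨ z·-cong (z·-cong (⊛-convergent m (suc i))) n (ℕ.m≤n⇒m≤1+n n≤) ⟩
        (z· z· G (suc (suc i))) n ∎

    -- At depth zero only constant terms are compared, and a reciprocal starts with `1#` by
    -- definition.
    ⊛-convergent zero i zero _ =
      trans (+-identityʳ _) (trans (*-identityʳ _) (trans (G-const i) (sym (G-const (suc i)))))
    ⊛-convergent (suc m) i n n≤ = begin
      (G i ⊛ C) n        ≈⟨ ⊛-congʳ C (⊛-denominator m i) n n≤ ⟨
      ((G₁ ⊛ D) ⊛ C) n   ≈⟨ ⊛-assoc G₁ D C n ⟩
      (G₁ ⊛ (D ⊛ C)) n   ≈⟨ ⊛-congˡ {n} G₁ (λ j _ → denominator⊛convergent (suc m) i j) n ℕ.≤-refl ⟩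
      (G₁ ⊛ one) n       ≈⟨ ⊛-identityʳ G₁ n ⟩
      G₁ n               ∎
      where
      G₁ = G (suc i)
      C = convergent (suc m) i
      D = denominator (suc m) i

    -- At level 0 the factor `G 0` is `one`, and coefficient `n` of the fraction is by definition
    -- that of the depth-`n` convergent, so agreement up to degree `n` is enough.
    jFraction-unique : jFraction ≐ G 1
    jFraction-unique n = begin
      C n          ≈⟨ ⊛-identityˡ C n ⟨
      (one ⊛ C) n  ≈⟨ ⊛-congʳ C (λ j _ → G₀ j) n ℕ.≤-refl ⟨
      (G 0 ⊛ C) n  ≈⟨ ⊛-convergent n 0 n ℕ.≤-refl ⟩
      G 1 n        ∎
      where C = convergent n 0

-- q-analogues

module QAnalogue {c₀ ℓ₀} (R : CommutativeRing c₀ ℓ₀) (q : CommutativeRing.Carrier R) where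
  open CommutativeRing R hiding (zero)
  open OverRing R
  open CauchyProduct R
  open import Relation.Binary.Reasoning.Setoid setoid
  open import Algebra.Properties.Semiring.Sum semiring
    using (sum; sum-cong-≋; *-distribˡ-sum)
  open import Algebra.Properties.Semiring.Exp semiring using (^-congˡ)
  open import Algebra.Properties.CommutativeSemiring.Exp commutativeSemiring using (^-distrib-*)
  open import Algebra.Solver.Ring.NaturalCoefficients.Default commutativeSemiring
    using (solve; _:=_; _:+_; _:*_; con)

  -- q-integers, q-factorials and Gaussian binomials.

  ⟦_⟧ : ℕ → Carrier
  ⟦ n ⟧ = sum {n} λ i → q ^ toℕ i

  ⟦_⟧! : ℕ → Carrier
  ⟦ zero  ⟧! = 1#
  ⟦ suc n ⟧! = ⟦ suc n ⟧ * ⟦ n ⟧!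

  -- The q-binomial coefficient of n + i over i.
  binomial : ℕ → ℕ → Carrier
  binomial zero    i       = 1#
  binomial (suc n) zero    = 1#
  binomial (suc n) (suc i) = binomial (suc n) i + q ^ suc i * binomial n (suc i)

  ⟦⟧-suc : ∀ n → ⟦ suc n ⟧ ≈ 1# + q * ⟦ n ⟧
  ⟦⟧-suc n = +-congˡ (sym (*-distribˡ-sum {n} q _))

  ⟦⟧-sucʳ : ∀ n → ⟦ suc n ⟧ ≈ ⟦ n ⟧ + q ^ n
  ⟦⟧-sucʳ zero    = +-comm _ _
  ⟦⟧-sucʳ (suc n) = begin
    ⟦ suc (suc n) ⟧          ≈⟨ ⟦⟧-suc (suc n) ⟩
    1# + q * ⟦ suc n ⟧       ≈⟨ +-congˡ (*-congˡ (⟦⟧-sucʳ n)) ⟩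
    1# + q * (⟦ n ⟧ + q ^ n)
      ≈⟨ solve 3 (λ q x y → con 1 :+ q :* (x :+ y) := (con 1 :+ q :* x) :+ q :* y) refl
           q ⟦ n ⟧ (q ^ n) ⟩
    1# + q * ⟦ n ⟧ + q * q ^ n ≈⟨ +-congʳ (⟦⟧-suc n) ⟨
    ⟦ suc n ⟧ + q ^ suc n    ∎

  binomial-zeroʳ : ∀ n → binomial n 0 ≈ 1#
  binomial-zeroʳ zero    = refl
  binomial-zeroʳ (suc n) = refl

  -- Both sides are `[n+i+2]`, cut after `i+1` or after `i+2` powers of `q`.
  ⟦⟧-split : ∀ i n →
    ⟦ suc i ⟧ + q ^ suc i * ⟦ suc n ⟧ ≈ ⟦ suc (suc i) ⟧ + q ^ suc (suc i) * ⟦ n ⟧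
  ⟦⟧-split i n = begin
    ⟦ suc i ⟧ + q ^ suc i * ⟦ suc n ⟧
      ≈⟨ +-congˡ (*-congˡ (⟦⟧-suc n)) ⟩
    ⟦ suc i ⟧ + q ^ suc i * (1# + q * ⟦ n ⟧)
      ≈⟨ solve 4 (λ a b q x → a :+ b :* (con 1 :+ q :* x) := (a :+ b) :+ q :* b :* x) refl
           ⟦ suc i ⟧ (q ^ suc i) q ⟦ n ⟧ ⟩
    ⟦ suc i ⟧ + q ^ suc i + q ^ suc (suc i) * ⟦ n ⟧
      ≈⟨ +-congʳ (⟦⟧-sucʳ (suc i)) ⟨
    ⟦ suc (suc i) ⟧ + q ^ suc (suc i) * ⟦ n ⟧ ∎

  -- Both sides stand for `[n+i+1]! / ([n]! [i]!)`. No division is available in `R`, so the proof is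
  -- an induction through the q-Pascal recurrence that defines `binomial`.
  binomial-absorb : ∀ n i → ⟦ suc n ⟧ * binomial (suc n) i ≈ ⟦ suc i ⟧ * binomial n (suc i)
  binomial-absorb zero zero = refl
  binomial-absorb zero (suc i) = begin
    ⟦ 1 ⟧ * (binomial 1 i + q ^ suc i * 1#)
      ≈⟨ distribˡ _ _ _ ⟩
    ⟦ 1 ⟧ * binomial 1 i + ⟦ 1 ⟧ * (q ^ suc i * 1#)
      ≈⟨ +-congʳ (binomial-absorb zero i) ⟩
    ⟦ suc i ⟧ * 1# + ⟦ 1 ⟧ * (q ^ suc i * 1#)
      ≈⟨ solve 2 (λ x y → x :* con 1 :+ (con 1 :+ con 0) :* (y :* con 1) := x :+ y) refl
           ⟦ suc i ⟧ (q ^ suc i) ⟩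
    ⟦ suc i ⟧ + q ^ suc i
      ≈⟨ ⟦⟧-sucʳ (suc i) ⟨
    ⟦ suc (suc i) ⟧
      ≈⟨ *-identityʳ _ ⟨
    ⟦ suc (suc i) ⟧ * 1# ∎
  binomial-absorb (suc n) zero = begin
    ⟦ suc (suc n) ⟧ * 1#
      ≈⟨ *-congʳ (⟦⟧-suc (suc n)) ⟩
    (1# + q * ⟦ suc n ⟧) * 1#
      ≈⟨ solve 2 (λ q x → (con 1 :+ q :* x) :* con 1 := con 1 :+ q :* (x :* con 1)) refl
           q ⟦ suc n ⟧ ⟩
    1# + q * (⟦ suc n ⟧ * 1#)
      ≈⟨ +-congˡ (*-congˡ (binomial-absorb n zero)) ⟩
    1# + q * (⟦ 1 ⟧ * binomial n 1)
      ≈⟨ solve 2 (λ q b → con 1 :+ q :* ((con 1 :+ con 0) :* b)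
                         := (con 1 :+ con 0) :* (con 1 :+ (q :* con 1) :* b)) refl
           q (binomial n 1) ⟩
    ⟦ 1 ⟧ * (1# + q ^ 1 * binomial n 1) ∎
  binomial-absorb (suc n) (suc i) = begin
    ⟦ suc (suc n) ⟧ * (binomial (suc (suc n)) i + q ^ suc i * X)
      ≈⟨ solve 4 (λ a b c x → a :* (b :+ c :* x) := a :* b :+ c :* a :* x) refl
           ⟦ suc (suc n) ⟧ (binomial (suc (suc n)) i) (q ^ suc i) X ⟩
    ⟦ suc (suc n) ⟧ * binomial (suc (suc n)) i + q ^ suc i * ⟦ suc (suc n) ⟧ * X
      ≈⟨ +-congʳ (binomial-absorb (suc n) i) ⟩
    ⟦ suc i ⟧ * X + q ^ suc i * ⟦ suc (suc n) ⟧ * X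
      ≈⟨ distribʳ X _ _ ⟨
    (⟦ suc i ⟧ + q ^ suc i * ⟦ suc (suc n) ⟧) * X
      -- Recutting the q-integer produces `⟦ suc n ⟧ * X`, to which the induction hypothesis in `n`
      -- applies.
      ≈⟨ *-congʳ (⟦⟧-split i (suc n)) ⟩
    (⟦ suc (suc i) ⟧ + q ^ suc (suc i) * ⟦ suc n ⟧) * X
      ≈⟨ solve 4 (λ a b c x → (a :+ b :* c) :* x := a :* x :+ b :* (c :* x)) refl
           ⟦ suc (suc i) ⟧ (q ^ suc (suc i)) ⟦ suc n ⟧ X ⟩
    ⟦ suc (suc i) ⟧ * X + q ^ suc (suc i) * (⟦ suc n ⟧ * X)
      ≈⟨ +-congˡ (*-congˡ (binomial-absorb n (suc i))) ⟩
    ⟦ suc (suc i) ⟧ * X + q ^ suc (suc i) * (⟦ suc (suc i) ⟧ * Y)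
      ≈⟨ solve 4 (λ a b x y → a :* x :+ b :* (a :* y) := a :* (x :+ b :* y)) refl
           ⟦ suc (suc i) ⟧ (q ^ suc (suc i)) X Y ⟩
    ⟦ suc (suc i) ⟧ * (X + q ^ suc (suc i) * Y) ∎
    where
    X = binomial (suc n) (suc i)
    Y = binomial n (suc (suc i))

  -- The quotients of consecutive terms of odd 0, even 1, odd 1, even 2, odd 2, … are the tails
  -- of the S-fraction with coefficients [1], q [1], q [2], q² [2], q² [3], …
  even odd : ℕ → Series
  even zero    = one
  even (suc i) n = ⟦ n ⟧! * (binomial n i * binomial n i)
  odd zero    = one
  odd (suc i) n = ⟦ n ⟧! * (binomial n (suc i) * binomial n i)

  -- For positive index and degree, the q-Pascal rule splits the factor `binomial (suc n) (suc i)`.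
  -- Its first term gives `even (suc i)`, and absorption turns the second into a multiple of
  -- `even (suc (suc i))` one degree lower.
  odd-step : ∀ i → odd i ≐ even i ⊕ (q ^ i * ⟦ i ⟧) • z· even (suc i)
  odd-step zero    zero    = solve 0 (con 1 := con 1 :+ con 1 :* con 0 :* con 0) refl
  odd-step zero    (suc n) =
    solve 1 (λ x → con 0 := con 0 :+ con 1 :* con 0 :* x) refl (even 1 n)
  odd-step (suc i) zero    =
    sym (trans (+-congˡ (zeroʳ _)) (+-identityʳ _))
  odd-step (suc i) (suc n) = begin
    ⟦ suc n ⟧ * ⟦ n ⟧! * ((x + q ^ suc i * y) * x)
      ≈⟨ solve 5 (λ a f x p y → a :* f :* ((x :+ p :* y) :* x)
                                  := a :* f :* (x :* x) :+ f :* p :* y :* (a :* x)) refl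
           ⟦ suc n ⟧ ⟦ n ⟧! x (q ^ suc i) y ⟩
    ⟦ suc n ⟧ * ⟦ n ⟧! * (x * x) + ⟦ n ⟧! * q ^ suc i * y * (⟦ suc n ⟧ * x)
      ≈⟨ +-congˡ (*-congˡ (binomial-absorb n i)) ⟩
    ⟦ suc n ⟧ * ⟦ n ⟧! * (x * x) + ⟦ n ⟧! * q ^ suc i * y * (⟦ suc i ⟧ * y)
      ≈⟨ +-congˡ (solve 4 (λ f p y b → f :* p :* y :* (b :* y) := p :* b :* (f :* (y :* y))) refl
           ⟦ n ⟧! (q ^ suc i) y ⟦ suc i ⟧) ⟩
    ⟦ suc n ⟧ * ⟦ n ⟧! * (x * x) + q ^ suc i * ⟦ suc i ⟧ * (⟦ n ⟧! * (y * y)) ∎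
    where
    x = binomial (suc n) i
    y = binomial n (suc i)

  -- As for `odd-step`, except that for positive index the two factors coincide: one is split by
  -- q-Pascal, and absorption is applied to the other, `z`.
  even-step : ∀ i → even (suc i) ≐ odd i ⊕ (q ^ i * ⟦ suc i ⟧) • z· odd (suc i)
  even-step zero    zero    =
    solve 1 (λ x → con 1 :* (con 1 :* con 1) := con 1 :+ con 1 :* x :* con 0) refl ⟦ 1 ⟧
  even-step zero    (suc n) = begin
    ⟦ suc n ⟧ * ⟦ n ⟧! * (1# * 1#)
      ≈⟨ solve 2 (λ a f → a :* f :* (con 1 :* con 1) := f :* (a :* con 1)) refl
           ⟦ suc n ⟧ ⟦ n ⟧! ⟩
    ⟦ n ⟧! * (⟦ suc n ⟧ * 1#)
      ≈⟨ *-congˡ (binomial-absorb n zero) ⟩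
    ⟦ n ⟧! * (⟦ 1 ⟧ * binomial n 1)
      ≈⟨ solve 3 (λ f a b → f :* (a :* b) := con 0 :+ con 1 :* a :* (f :* (b :* con 1))) refl
           ⟦ n ⟧! ⟦ 1 ⟧ (binomial n 1) ⟩
    0# + 1# * ⟦ 1 ⟧ * (⟦ n ⟧! * (binomial n 1 * 1#))
      ≈⟨ +-congˡ (*-congˡ (*-congˡ (*-congˡ (binomial-zeroʳ n)))) ⟨
    0# + 1# * ⟦ 1 ⟧ * (⟦ n ⟧! * (binomial n 1 * binomial n 0)) ∎
  even-step (suc i) zero    =
    sym (trans (+-congˡ (zeroʳ _)) (+-identityʳ _))
  even-step (suc i) (suc n) = begin
    ⟦ suc n ⟧ * ⟦ n ⟧! * (z * (x + p * y))
      ≈⟨ solve 6 (λ a f z x p y → a :* f :* (z :* (x :+ p :* y))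
                                    := a :* f :* (z :* x) :+ p :* f :* y :* (a :* z)) refl
           ⟦ suc n ⟧ ⟦ n ⟧! z x p y ⟩
    ⟦ suc n ⟧ * ⟦ n ⟧! * (z * x) + p * ⟦ n ⟧! * y * (⟦ suc n ⟧ * z)
      ≈⟨ +-congˡ (*-congˡ (binomial-absorb n (suc i))) ⟩
    ⟦ suc n ⟧ * ⟦ n ⟧! * (z * x) + p * ⟦ n ⟧! * y * (⟦ suc (suc i) ⟧ * w)
      ≈⟨ +-congˡ (solve 5 (λ p f y b w → p :* f :* y :* (b :* w) := p :* b :* (f :* (w :* y))) refl
           p ⟦ n ⟧! y ⟦ suc (suc i) ⟧ w) ⟩
    ⟦ suc n ⟧ * ⟦ n ⟧! * (z * x) + p * ⟦ suc (suc i) ⟧ * (⟦ n ⟧! * (w * y)) ∎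
    where
    p = q ^ suc i
    x = binomial (suc n) i
    y = binomial n (suc i)
    z = binomial (suc n) (suc i)
    w = binomial n (suc (suc i))

  -- The coefficients of the J-fraction in closed form.

  ⟨⟩-suc : ∀ n x y → [ suc n ]⟨ x , y ⟩ ≈ x ^ n + y * [ n ]⟨ x , y ⟩
  ⟨⟩-suc zero    x y = +-cong (*-identityʳ _) (sym (zeroʳ _))
  ⟨⟩-suc (suc n) x y = +-cong (*-identityʳ _) (trans
    (sum-cong-≋ {suc n} λ i →
      solve 3 (λ a y b → a :* (y :* b) := y :* (a :* b)) refl (x ^ (n ∸ toℕ i)) y (y ^ toℕ i))
    (sym (*-distribˡ-sum {suc n} y (λ i → x ^ (n ∸ toℕ i) * y ^ toℕ i))))

  -- Term `i` is `q^(n-i) q^(2i) = q^n q^i`, so `q^n` factors out.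
  ⟨q,q²⟩ : ∀ n → [ suc n ]⟨ q , q ^ 2 ⟩ ≈ q ^ n * ⟦ suc n ⟧
  ⟨q,q²⟩ zero    = solve 0 (con 1 :* con 1 :+ con 0 := con 1 :* (con 1 :+ con 0)) refl
  ⟨q,q²⟩ (suc n) = begin
    [ suc (suc n) ]⟨ q , q ^ 2 ⟩                ≈⟨ ⟨⟩-suc (suc n) q (q ^ 2) ⟩
    q ^ suc n + q ^ 2 * [ suc n ]⟨ q , q ^ 2 ⟩  ≈⟨ +-congˡ (*-congˡ (⟨q,q²⟩ n)) ⟩
    q ^ suc n + q ^ 2 * (q ^ n * ⟦ suc n ⟧)
      ≈⟨ solve 3 (λ q p x → q :* p :+ q :* (q :* con 1) :* (p :* x)
                           := q :* p :* (con 1 :+ q :* x)) refl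
           q (q ^ n) ⟦ suc n ⟧ ⟩
    q ^ suc n * (1# + q * ⟦ suc n ⟧)            ≈⟨ *-congˡ (⟦⟧-suc (suc n)) ⟨
    q ^ suc n * ⟦ suc (suc n) ⟧                 ∎

  private P = inversionParameters q

  -- The two summands are the S-fraction coefficients that meet at level `n` in the even
  -- contraction. Since `w = 0`, the term `u w^n` contributes only at `n = 0`.
  α-closed : ∀ n → α P n ≈ q ^ n * ⟦ n ⟧ + q ^ n * ⟦ suc n ⟧
  α-closed zero = solve 2 (λ q² s →
      con 1 :* con 1 :+ s :* con 0 :+ q² :* con 0
        := con 1 :* con 0 :+ con 1 :* (con 1 :+ con 0)) refl (q ^ 2) (2 · q)
  α-closed (suc n) = begin
    1# * (0# * 0# ^ n) + 2 · q * [ suc n ]⟨ q , q ^ 2 ⟩ + q ^ 2 * [ suc n ]⟨ q ^ 2 , 0# ⟩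
      ≈⟨ +-cong (+-congˡ (*-congˡ (⟨q,q²⟩ n)))
                -- Since `g = 0`, only the leading power `(q²)^n = q^n q^n` survives; the other
                -- terms carry a factor `0#` and vanish in the next step.
                (*-congˡ (trans (⟨⟩-suc n (q ^ 2) 0#)
                  (+-congʳ (trans (^-congˡ n (*-congˡ (*-identityʳ q))) (^-distrib-* q q n))))) ⟩
    1# * (0# * 0# ^ n) + 2 · q * (p * x) + q ^ 2 * (p * p + 0# * [ n ]⟨ q ^ 2 , 0# ⟩)
      ≈⟨ solve 5 (λ o q p x r →
           con 1 :* (con 0 :* o) :+ (q :+ (q :+ con 0)) :* (p :* x)
             :+ q :* (q :* con 1) :* (p :* p :+ con 0 :* r)
           := q :* p :* x :+ q :* p :* (x :+ q :* p)) refl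
           (0# ^ n) q p x [ n ]⟨ q ^ 2 , 0# ⟩ ⟩
    q ^ suc n * x + q ^ suc n * (x + q ^ suc n)
      ≈⟨ +-congˡ (*-congˡ (⟦⟧-sucʳ (suc n))) ⟨
    q ^ suc n * x + q ^ suc n * ⟦ suc (suc n) ⟧ ∎
    where
    p = q ^ n
    x = ⟦ suc n ⟧

  -- The factors are the consecutive S-fraction coefficients whose product the even contraction
  -- calls for; `r = q` supplies the extra power in the second.
  β-closed : ∀ n → β P (suc n) ≈ (q ^ n * ⟦ suc n ⟧) * (q ^ suc n * ⟦ suc n ⟧)
  β-closed n = trans (*-cong (*-congˡ (⟨q,q²⟩ n)) (⟨q,q²⟩ n))
    (solve 3 (λ q p x → con 1 :* q :* (p :* x) :* (p :* x) := (p :* x) :* (q :* p :* x)) refl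
      q (q ^ n) ⟦ suc n ⟧)

  -- Even contraction: `odd-step` at `i` and, shifted by `z`, at `suc i` eliminates the odd series
  -- from `even-step`.
  even-recurrence : ∀ i →
    even i ⊕ (α P i • z· even (suc i) ⊕ β P (suc i) • z· z· even (suc (suc i))) ≐ even (suc i)
  even-recurrence i n = begin
    even i n + (α P i * (z· even (suc i)) n + β P (suc i) * (z· z· even (suc (suc i))) n)
      ≈⟨ +-congˡ (+-cong (*-congʳ (α-closed i)) (*-congʳ (β-closed i))) ⟩
    even i n + ((a + b) * (z· even (suc i)) n + b * c * (z· z· even (suc (suc i))) n)
      ≈⟨ solve 6 (λ e a b c x y → e :+ ((a :+ b) :* x :+ b :* c :* y)
                                    := (e :+ a :* x) :+ b :* (x :+ c :* y)) refl
           (even i n) a b c ((z· even (suc i)) n) ((z· z· even (suc (suc i))) n) ⟩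
    (even i n + a * (z· even (suc i)) n)
      + b * ((z· even (suc i)) n + c * (z· z· even (suc (suc i))) n)
      ≈⟨ +-cong (odd-step i n) (*-congˡ (z·odd n)) ⟨
    odd i n + b * (z· odd (suc i)) n
      ≈⟨ even-step i n ⟨
    even (suc i) n ∎
    where
    a = q ^ i * ⟦ i ⟧
    b = q ^ i * ⟦ suc i ⟧
    c = q ^ suc i * ⟦ suc i ⟧
    z·odd : ∀ n → (z· odd (suc i)) n ≈ (z· even (suc i)) n + c * (z· z· even (suc (suc i))) n
    z·odd zero    = sym (trans (+-congˡ (zeroʳ _)) (+-identityʳ _))
    z·odd (suc n) = odd-step (suc i) n

  𝒞≈factorial : ∀ n → 𝒞 P n ≈ ⟦ n ⟧!
  𝒞≈factorial n = begin
    𝒞 P n     ≈⟨ jFraction-unique (α P) (β P) even (λ _ → refl) even-const even-recurrence n ⟩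
    even 1 n  ≈⟨ *-congˡ (*-cong (binomial-zeroʳ n) (binomial-zeroʳ n)) ⟩
    ⟦ n ⟧! * (1# * 1#) ≈⟨ trans (*-congˡ (*-identityʳ _)) (*-identityʳ _) ⟩
    ⟦ n ⟧! ∎
    where
    even-const : ∀ i → even i 0 ≈ 1#
    even-const zero    = refl
    even-const (suc i) = trans (*-identityˡ _) (*-identityʳ _)

-- Arrangements of a list of letters

private variable
  a b c p ℓ : Level
  A : Set a
  B : Set b
  C : Set c

module Arrangements where
  open import Data.Nat.Base using (_+_)
  open +-*-Solver using (solve; _:=_; _:+_)
  open import Relation.Binary.PropositionalEquality
    using (refl; sym; trans; cong; cong₂; subst; module ≡-Reasoning)

  -- Counting list entries and inversions.

  module _ {A : Set a} {P : Pred A p} (P? : Decidable P) where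

    count : List A → ℕ
    count = length ∘ filter P?

    count-∷ : ∀ x xs → count (x ∷ xs) ≡ (if does (P? x) then 1 else 0) + count xs
    count-∷ x xs with does (P? x)
    ... | true  = refl
    ... | false = refl

    count-++ : ∀ xs ys → count (xs ++ ys) ≡ count xs + count ys
    count-++ xs ys = trans (cong length (List.filter-++ P? xs ys)) (List.length-++ (filter P? xs))

    count-none : ∀ {xs} → All (¬_ ∘ P) xs → count xs ≡ 0
    count-none = cong length ∘ List.filter-none P?

    count-accept : ∀ {x} xs → P x → count (x ∷ xs) ≡ suc (count xs)
    count-accept xs px = cong length (List.filter-accept P? px)

    count-↭ : ∀ {xs ys} → xs ↭ ys → count xs ≡ count ys
    count-↭ = ↭-length ∘ filter-↭ P?

    count-map : (f : B → A) → ∀ xs → count (List.map f xs) ≡ length (filter (P? ∘ f) xs)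
    count-map f [] = refl
    count-map f (x ∷ xs) with does (P? (f x))
    ... | true  = cong suc (count-map f xs)
    ... | false = count-map f xs

  count-cong : ∀ {p q} {P : Pred A p} {Q : Pred A q} (P? : Decidable P) (Q? : Decidable Q) →
               (∀ x → does (P? x) ≡ does (Q? x)) → ∀ xs → count P? xs ≡ count Q? xs
  count-cong P? Q? P≗Q [] = refl
  count-cong P? Q? P≗Q (x ∷ xs) =
    trans (count-∷ P? x xs) (trans
      (cong₂ _+_ (cong (if_then 1 else 0) (P≗Q x)) (count-cong P? Q? P≗Q xs))
      (sym (count-∷ Q? x xs)))

  count-cartesianProduct : ∀ {P : Pred (A × B) p} (P? : Decidable P) xs ys →
    count P? (cartesianProduct xs ys) ≡ ListAction.sum (List.map (λ x → count (P? ∘ (x ,_)) ys) xs)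
  count-cartesianProduct P? []       ys = refl
  count-cartesianProduct P? (x ∷ xs) ys =
    trans (count-++ P? (List.map (x ,_) ys) (cartesianProduct xs ys))
      (cong₂ _+_ (count-map P? (x ,_) ys) (count-cartesianProduct P? xs ys))

  allFin-suc : ∀ n → allFin (suc n) ≡ zero ∷ List.map suc (allFin n)
  allFin-suc n = cong (zero ∷_) (sym (List.map-tabulate id suc))

  map-lookup-allFin : ∀ {n} (v : Vec A n) → List.map (lookup v) (allFin n) ≡ toList v
  map-lookup-allFin []      = refl
  map-lookup-allFin {n = suc n} (x ∷ v) = trans
    (cong (List.map (lookup (x ∷ v))) (allFin-suc n))
    (cong (x ∷_) (trans (sym (List.map-∘ (allFin n))) (map-lookup-allFin v)))

  module _ {A : Set a} {_>_ : Rel A ℓ} (_>?_ : B.Decidable _>_) where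

    -- Pairs are grouped by first position: row zero compares `x` with every later letter. Column
    -- zero is empty in all rows, as no position precedes zero, so the other rows form the table of
    -- `v`.
    inversions-∷ : ∀ {n} x (v : Vec A n) →
      inversions _>?_ (x ∷ v) ≡ count (x >?_) (toList v) + inversions _>?_ v
    inversions-∷ {n} x v = begin
      inversions _>?_ (x ∷ v)
        ≡⟨ count-cartesianProduct inv? (allFin (suc n)) (allFin (suc n)) ⟩
      ListAction.sum (List.map row (allFin (suc n)))
        ≡⟨ cong (ListAction.sum ∘ List.map row) (allFin-suc n) ⟩
      row zero + ListAction.sum (List.map row (List.map suc (allFin n)))
        ≡⟨ cong₂ _+_ row-zero (cong ListAction.sum (trans
             (sym (List.map-∘ (allFin n))) (List.map-cong row-suc (allFin n)))) ⟩
      count (x >?_) (toList v) + ListAction.sum (List.map row′ (allFin n))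
        ≡⟨ cong (count (x >?_) (toList v) +_) (count-cartesianProduct inv?′ (allFin n) (allFin n)) ⟨
      count (x >?_) (toList v) + inversions _>?_ v ∎
      where
      open ≡-Reasoning
      inv? : Decidable {A = Fin (suc n) × Fin (suc n)} _
      inv? (i , j) = (i Fin.<? j) ×-dec (lookup (x ∷ v) i >? lookup (x ∷ v) j)
      inv?′ : Decidable {A = Fin n × Fin n} _
      inv?′ (i , j) = (i Fin.<? j) ×-dec (lookup v i >? lookup v j)
      row : Fin (suc n) → ℕ
      row i = count (inv? ∘ (i ,_)) (allFin (suc n))
      row′ : Fin n → ℕ
      row′ i = count (λ j → inv?′ (i , j)) (allFin n)
      row-zero : row zero ≡ count (x >?_) (toList v)
      row-zero = begin
        row zero
          ≡⟨ cong (count (λ j → inv? (zero , j))) (allFin-suc n) ⟩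
        count (λ j → inv? (zero , j)) (List.map suc (allFin n))
          ≡⟨ count-map (λ j → inv? (zero , j)) suc (allFin n) ⟩
        count (λ j → inv? (zero , suc j)) (allFin n)
          ≡⟨ count-cong (λ j → inv? (zero , suc j)) ((x >?_) ∘ lookup v) (λ _ → refl) (allFin n) ⟩
        count ((x >?_) ∘ lookup v) (allFin n)
          ≡⟨ count-map (x >?_) (lookup v) (allFin n) ⟨
        count (x >?_) (List.map (lookup v) (allFin n))
          ≡⟨ cong (count (x >?_)) (map-lookup-allFin v) ⟩
        count (x >?_) (toList v) ∎
      row-suc : ∀ i → row (suc i) ≡ row′ i
      row-suc i = begin
        row (suc i)
          ≡⟨ cong (count (λ j → inv? (suc i , j))) (allFin-suc n) ⟩
        count (λ j → inv? (suc i , j)) (List.map suc (allFin n))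
          ≡⟨ count-map (λ j → inv? (suc i , j)) suc (allFin n) ⟩
        count (λ j → inv? (suc i , suc j)) (allFin n)
          ≡⟨ count-cong (λ j → inv? (suc i , suc j)) (λ j → inv?′ (i , j)) (λ _ → refl) (allFin n) ⟩
        row′ i ∎

  -- Splits off the pairs that end at the appended entry and moves `f` from the letters into the
  -- relation, so that coloured inversions become inversions of `v` for another order.
  inversions-map-∷ʳ : ∀ {A : Set a} {B : Set b} {_>_ : Rel A ℓ} (_>?_ : B.Decidable _>_)
    (f : B → A) y {n} (v : Vec B n) →
    inversions _>?_ (Vec.map f v ∷ʳ y)
      ≡ count (λ x → f x >? y) (toList v) + inversions (λ x x′ → f x >? f x′) v
  inversions-map-∷ʳ _>?_ f y []      = inversions-∷ _>?_ y []
  inversions-map-∷ʳ _>?_ f y (x ∷ v) = begin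
    inversions _>?_ (f x ∷ (Vec.map f v ∷ʳ y))
      ≡⟨ inversions-∷ _>?_ (f x) (Vec.map f v ∷ʳ y) ⟩
    count (f x >?_) (toList (Vec.map f v ∷ʳ y)) + inversions _>?_ (Vec.map f v ∷ʳ y)
      ≡⟨ cong₂ _+_ first (inversions-map-∷ʳ _>?_ f y v) ⟩
    (k + m) + (l + o)
      ≡⟨ solve 4 (λ k m l o → (k :+ m) :+ (l :+ o) := (m :+ l) :+ (k :+ o)) refl k m l o ⟩
    (m + l) + (k + o)
      ≡⟨ cong₂ _+_ (count-∷ (λ x → f x >? y) x (toList v))
                   (inversions-∷ (λ x x′ → f x >? f x′) x v) ⟨
    count (λ x → f x >? y) (x ∷ toList v) + inversions (λ x x′ → f x >? f x′) (x ∷ v) ∎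
    where
    open ≡-Reasoning
    k = count (λ x′ → f x >? f x′) (toList v)
    l = count (λ x → f x >? y) (toList v)
    m = if does (f x >? y) then 1 else 0
    o = inversions (λ x x′ → f x >? f x′) v
    first : count (f x >?_) (toList (Vec.map f v ∷ʳ y)) ≡ k + m
    first = begin
      count (f x >?_) (toList (Vec.map f v ∷ʳ y))
        ≡⟨ cong (count (f x >?_)) (Vec.toList-∷ʳ y (Vec.map f v)) ⟩
      count (f x >?_) (toList (Vec.map f v) ++ y ∷ [])
        ≡⟨ count-++ (f x >?_) (toList (Vec.map f v)) (y ∷ []) ⟩
      count (f x >?_) (toList (Vec.map f v)) + count (f x >?_) (y ∷ [])
        ≡⟨ cong₂ _+_ (trans (cong (count (f x >?_)) (Vec.toList-map f v))
                            (count-map (f x >?_) f (toList v)))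
                     (trans (count-∷ (f x >?_) y []) (ℕ.+-identityʳ m)) ⟩
      k + m ∎

  -- Enumerating arrangements by insertion.

  -- The head is inserted last, so if `L` is increasing, every inserted letter is below all letters
  -- already placed.
  arrangements : ∀ {n} → Vec A n → List (Vec A n)
  arrangements []      = [] ∷ []
  arrangements {n = suc n} (x ∷ L) =
    cartesianProductWith (λ w i → insertAt w i x) (arrangements L) (allFin (suc n))

  toList-insertAt-↭ : ∀ {n} (w : Vec A n) i x → toList (insertAt w i x) ↭ x ∷ toList w
  toList-insertAt-↭ w       zero    x = ↭-refl
  toList-insertAt-↭ (y ∷ w) (suc i) x =
    ↭-trans (Perm.prep y (toList-insertAt-↭ w i x)) (Perm.swap y x ↭-refl)

  ∈-toList⁻ : ∀ {n x} {w : Vec A (suc n)} → x ∈ toList w → ∃₂ λ v i → w ≡ insertAt v i x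
  ∈-toList⁻ {w = y ∷ w}     (here refl) = w , zero , refl
  ∈-toList⁻ {w = y ∷ z ∷ w} (there x∈w) with v , i , eq ← ∈-toList⁻ {w = z ∷ w} x∈w =
    y ∷ v , suc i , cong (y ∷_) eq

  ∈-arrangements⁻ : ∀ {n} (L : Vec A n) {w} → w ∈ arrangements L → toList w ↭ toList L
  ∈-arrangements⁻ []      (here refl) = ↭-refl
  ∈-arrangements⁻ {n = suc n} (x ∷ L) w∈
    with v , i , v∈ , _ , refl ← ∈-cartesianProductWith⁻ (λ w i → insertAt w i x)
                                  (arrangements L) (allFin (suc n)) w∈
    = ↭-trans (toList-insertAt-↭ v i x) (Perm.prep x (∈-arrangements⁻ L v∈))

  ∈-arrangements⁺ : ∀ {n} (L : Vec A n) {w} → toList w ↭ toList L → w ∈ arrangements L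
  ∈-arrangements⁺ []      {[]} _ = here refl
  ∈-arrangements⁺ (x ∷ L) {w} w↭
    with v , i , refl ← ∈-toList⁻ {w = w} (∈-resp-↭ (↭-sym w↭) (here refl))
    = ∈-cartesianProductWith⁺ (λ w i → insertAt w i x)
        (∈-arrangements⁺ L (drop-∷ (↭-trans (↭-sym (toList-insertAt-↭ v i x)) w↭)))
        (∈-allFin i)

  -- Since `x` occurs in neither word, its place in the result gives the position, and the remaining
  -- letters give the word.
  insertAt-injective : ∀ {n x} {v w : Vec A n} {i j} → x ∉ toList v → x ∉ toList w →
    insertAt v i x ≡ insertAt w j x → v ≡ w × i ≡ j
  insertAt-injective {i = zero} {zero} _ _ refl = refl , refl
  insertAt-injective {w = _ ∷ _} {i = zero} {suc j} _ x∉w eq =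
    contradiction (here (Vec.∷-injectiveˡ eq)) x∉w
  insertAt-injective {v = _ ∷ _} {i = suc i} {zero} x∉v _ eq =
    contradiction (here (sym (Vec.∷-injectiveˡ eq))) x∉v
  insertAt-injective {v = _ ∷ _} {w = _ ∷ _} {i = suc i} {suc j} x∉v x∉w eq
    with refl , eq′ ← Vec.∷-injective eq
    with refl , refl ← insertAt-injective (x∉v ∘ there) (x∉w ∘ there) eq′ = refl , refl

  -- Injectivity is asked only on members of `xs`, to fit the insertion of a letter into words that
  -- avoid it.
  Unique-cartesianProductWith : ∀ (f : A → B → C) {xs ys} →
    (∀ {w x y z} → w ∈ xs → x ∈ xs → f w y ≡ f x z → w ≡ x × y ≡ z) →
    Unique xs → Unique ys → Unique (cartesianProductWith f xs ys)
  Unique-cartesianProductWith f inj [] _ = []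
  Unique-cartesianProductWith f {x ∷ xs} {ys} inj (x≢ ∷ xs!) ys! = Unique.++⁺
    (Unique.map⁺ (proj₂ ∘ inj (here refl) (here refl)) ys!)
    (Unique-cartesianProductWith f (λ w∈ x∈ → inj (there w∈) (there x∈)) xs! ys!)
    λ (v∈map , v∈rest) → disjoint v∈map v∈rest
    where
    disjoint : ∀ {v} → v ∈ List.map (f x) ys → v ∉ cartesianProductWith f xs ys
    disjoint v∈map v∈rest
      with _ , _ , refl ← ∈-map⁻ (f x) v∈map
      with w , _ , w∈ , _ , eq ← ∈-cartesianProductWith⁻ f xs ys v∈rest
      = All.lookup x≢ w∈ (proj₁ (inj (here refl) (there w∈) eq))

  Unique-arrangements : ∀ {n} {L : Vec A n} → Unique (toList L) → Unique (arrangements L)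
  Unique-arrangements {L = []}    _         = [] ∷ []
  Unique-arrangements {n = suc n} {L = x ∷ L} L!@(_ ∷ L!′) = Unique-cartesianProductWith _
    (λ v∈ w∈ → insertAt-injective (x∉ v∈) (x∉ w∈))
    (Unique-arrangements L!′) (Unique.allFin⁺ (suc n))
    where
    x∉ : ∀ {v} → v ∈ arrangements L → x ∉ toList v
    x∉ v∈ = Unique.Unique[x∷xs]⇒x∉xs L! ∘ ∈-resp-↭ (∈-arrangements⁻ L v∈)

  -- Words and permutations as lists without repetition.

  ∈-words : ∀ {k n} (v : Vec (Fin k) n) → v ∈ words k n
  ∈-words []      = here refl
  ∈-words (x ∷ v) = ∈-cartesianProductWith⁺ _∷_ (∈-allFin x) (∈-words v)

  Unique-words : ∀ k n → Unique (words k n)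
  Unique-words k zero    = [] ∷ []
  Unique-words k (suc n) =
    Unique.cartesianProductWith⁺ _∷_ Vec.∷-injective (Unique.allFin⁺ k) (Unique-words k n)

  Unique-𝒮 : ∀ n → Unique (𝒮 n)
  Unique-𝒮 n = Unique.filter⁺ isPermutation? (Unique-words n n)

  -- Serves to compare different enumerations of one set: sums are invariant under `↭`, so it
  -- remains to check membership both ways.
  set⇒↭ : {xs ys : List A} → Unique xs → Unique ys →
          (∀ {x} → x ∈ xs → x ∈ ys) → (∀ {x} → x ∈ ys → x ∈ xs) → xs ↭ ys
  set⇒↭ xs! ys! to from = ∼bag⇒↭ (unique∧set⇒bag xs! ys! (mk⇔ to from))

  ∈-𝒮⁻ : ∀ {n} {π : Vec (Fin n) n} → π ∈ 𝒮 n → IsPermutation π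
  ∈-𝒮⁻ {n} = proj₂ ∘ ∈-filter⁻ isPermutation? {xs = words n n}

  lookup-∈ : ∀ {n} (v : Vec A n) i → lookup v i ∈ toList v
  lookup-∈ v i = Vec.∈-toList⁺ (Vec.∈-lookup i v)

  Unique⇒lookup-injective : ∀ {n} (v : Vec A n) → Unique (toList v) →
                            ∀ {i j} → lookup v i ≡ lookup v j → i ≡ j
  Unique⇒lookup-injective (x ∷ v) (x≢ ∷ v!) {zero}  {zero}  eq = refl
  Unique⇒lookup-injective (x ∷ v) (x≢ ∷ v!) {zero}  {suc j} eq =
    contradiction eq (All.lookup x≢ (lookup-∈ v j))
  Unique⇒lookup-injective (x ∷ v) (x≢ ∷ v!) {suc i} {zero}  eq =
    contradiction (sym eq) (All.lookup x≢ (lookup-∈ v i))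
  Unique⇒lookup-injective (x ∷ v) (x≢ ∷ v!) {suc i} {suc j} eq =
    cong suc (Unique⇒lookup-injective v v! eq)

  lookup-injective⇒Unique : ∀ {n} (v : Vec A n) →
    (∀ {i j} → lookup v i ≡ lookup v j → i ≡ j) → Unique (toList v)
  lookup-injective⇒Unique {n = n} v inj =
    subst Unique (map-lookup-allFin v) (Unique.map⁺ inj (Unique.allFin⁺ n))

  IsPermutation⇒↭ : ∀ {n} {π : Vec (Fin n) n} → IsPermutation π → toList π ↭ allFin n
  IsPermutation⇒↭ {n} {π} (inj , surj) =
    set⇒↭ (lookup-injective⇒Unique π inj) (Unique.allFin⁺ n)
      (λ {x} _ → ∈-allFin x)
      (λ {x} _ → subst (_∈ toList π) (proj₂ (surj x) refl) (lookup-∈ π (proj₁ (surj x))))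

  Unique-resp-↭ : {xs ys : List A} → xs ↭ ys → Unique xs → Unique ys
  Unique-resp-↭ = SetoidPerm.Unique-resp-↭ (≡.setoid _) ∘ ↭⇒↭ₛ

  ↭⇒IsPermutation : ∀ {n} {π : Vec (Fin n) n} → toList π ↭ allFin n → IsPermutation π
  ↭⇒IsPermutation {n} {π} π↭ =
    Unique⇒lookup-injective π (Unique-resp-↭ (↭-sym π↭) (Unique.allFin⁺ n)) ,
    λ y → let y∈π = Vec.∈-toList⁻ (∈-resp-↭ (↭-sym π↭) (∈-allFin y))
          in VecAny.index y∈π , λ { refl → sym (VecAny.lookup-index y∈π) }

  -- `L` may list the letters in any order; it is later chosen increasing for the order whose
  -- inversions are counted.
  𝒮↭arrangements : ∀ {n} {L : Vec (Fin n) n} → toList L ↭ allFin n → 𝒮 n ↭ arrangements L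
  𝒮↭arrangements {n} {L} L↭ = set⇒↭ (Unique-𝒮 n)
    (Unique-arrangements (Unique-resp-↭ (↭-sym L↭) (Unique.allFin⁺ n)))
    (λ {π} π∈ → ∈-arrangements⁺ L (↭-trans (IsPermutation⇒↭ {π = π} (∈-𝒮⁻ π∈)) (↭-sym L↭)))
    (λ {π} π∈ → ∈-filter⁺ isPermutation? (∈-words π)
      (↭⇒IsPermutation (↭-trans (∈-arrangements⁻ L π∈) L↭)))

  lookup-extensional : ∀ {n} {v w : Vec A n} → (∀ i → lookup v i ≡ lookup w i) → v ≡ w
  lookup-extensional {v = v} {w} v≗w = trans (sym (Vec.tabulate∘lookup v))
    (trans (Vec.tabulate-cong v≗w) (Vec.tabulate∘lookup w))

  -- A permutation acts bijectively on colourings by `d ↦ d ∘ π`, with inverse `c ↦ c ∘ π⁻¹`. Sums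
  -- over colours of positions thereby become sums over colours of letters.
  map-lookup-words-↭ : ∀ {k n} {π : Vec (Fin n) n} → IsPermutation π →
    List.map (λ d → Vec.map (lookup d) π) (words k n) ↭ words k n
  map-lookup-words-↭ {k} {n} {π} (inj , surj) = set⇒↭
    (Unique.map⁺ injective (Unique-words k n)) (Unique-words k n)
    (λ {c} _ → ∈-words c)
    λ {c} _ → subst (_∈ _) (section c) (∈-map⁺ _ (∈-words (Vec.tabulate (lookup c ∘ π⁻¹))))
    where
    open ≡-Reasoning
    π⁻¹ : Fin n → Fin n
    π⁻¹ = proj₁ ∘ surj
    π∘π⁻¹ : ∀ x → lookup π (π⁻¹ x) ≡ x
    π∘π⁻¹ x = proj₂ (surj x) refl
    injective : ∀ {d e : Vec (Fin k) n} → Vec.map (lookup d) π ≡ Vec.map (lookup e) π → d ≡ e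
    injective {d} {e} eq = lookup-extensional λ x → begin
      lookup d x                             ≡⟨ cong (lookup d) (π∘π⁻¹ x) ⟨
      lookup d (lookup π (π⁻¹ x))            ≡⟨ Vec.lookup-map (π⁻¹ x) (lookup d) π ⟨
      lookup (Vec.map (lookup d) π) (π⁻¹ x)  ≡⟨ cong (λ v → lookup v (π⁻¹ x)) eq ⟩
      lookup (Vec.map (lookup e) π) (π⁻¹ x)  ≡⟨ Vec.lookup-map (π⁻¹ x) (lookup e) π ⟩
      lookup e (lookup π (π⁻¹ x))            ≡⟨ cong (lookup e) (π∘π⁻¹ x) ⟩
      lookup e x                             ∎
    section : ∀ c → Vec.map (lookup (Vec.tabulate (lookup c ∘ π⁻¹))) π ≡ c
    section c = lookup-extensional λ i → begin
      lookup (Vec.map (lookup (Vec.tabulate (lookup c ∘ π⁻¹))) π) i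
        ≡⟨ Vec.lookup-map i _ π ⟩
      lookup (Vec.tabulate (lookup c ∘ π⁻¹)) (lookup π i)
        ≡⟨ Vec.lookup∘tabulate (lookup c ∘ π⁻¹) (lookup π i) ⟩
      lookup c (π⁻¹ (lookup π i))
        -- Surjectivity gives a right inverse; injectivity of `π` makes it a left inverse as well.
        ≡⟨ cong (lookup c) (inj (π∘π⁻¹ (lookup π i))) ⟩
      lookup c i ∎

  -- Increasing listings and insertion of a least letter.

  module _ {a ℓ₁ ℓ₂} (O : StrictTotalOrder a ℓ₁ ℓ₂) where
    open StrictTotalOrder O using (Carrier; _≈_) renaming (_<_ to _⊏_)
    open import Relation.Binary.Properties.StrictTotalOrder O using (decTotalOrder; totalOrder)
    open import Data.List.Sort decTotalOrder using (sort; sort-↭; sort-↗)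
    open import Data.List.Relation.Unary.Sorted.TotalOrder.Properties using (Sorted⇒AllPairs)

    -- Sorting yields a weakly increasing list, and the absence of repetitions makes every
    -- inequality strict.
    sorted-arrangement : (∀ {x y} → x ≈ y → x ≡ y) → ∀ {xs : List Carrier} → Unique xs →
      ∀ {n} → length xs ≡ n → ∃ λ (L : Vec Carrier n) → toList L ↭ xs × AllPairs _⊏_ (toList L)
    sorted-arrangement ≈⇒≡ {xs} xs! refl =
      subst (λ n → ∃ λ (L : Vec Carrier n) → toList L ↭ xs × AllPairs _⊏_ (toList L))
        (↭-length (sort-↭ xs))
        (Vec.fromList (sort xs) ,
         subst (λ ys → ys ↭ xs × AllPairs _⊏_ ys) (sym (Vec.toList∘fromList (sort xs)))
           (sort-↭ xs , AllPairs.zipWith strict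
             (Sorted⇒AllPairs totalOrder (sort-↗ xs) , Unique-resp-↭ (↭-sym (sort-↭ xs)) xs!)))
      where
      strict : ∀ {x y} → (x ⊏ y ⊎ x ≈ y) × x ≢ y → x ⊏ y
      strict (inj₁ x⊏y , _)   = x⊏y
      strict (inj₂ x≈y , x≢y) = contradiction (≈⇒≡ x≈y) x≢y

  -- A least letter at position `i` forms an inversion with each of the `i` letters before it and
  -- with none after it.
  inversions-insertAt : ∀ {A : Set a} {_>_ : Rel A ℓ} (_>?_ : B.Decidable _>_) {n x} {w : Vec A n} →
    All (λ y → y > x × ¬ x > y) (toList w) → ∀ i →
    inversions _>?_ (insertAt w i x) ≡ toℕ i + inversions _>?_ w
  inversions-insertAt _>?_ {x = x} {w} min zero =
    trans (inversions-∷ _>?_ x w)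
      (cong (_+ inversions _>?_ w) (count-none (x >?_) (All.map proj₂ min)))
  inversions-insertAt _>?_ {x = x} {y ∷ w} ((y>x , _) ∷ min) (suc i) = begin
    inversions _>?_ (y ∷ insertAt w i x)
      ≡⟨ inversions-∷ _>?_ y (insertAt w i x) ⟩
    count (y >?_) (toList (insertAt w i x)) + inversions _>?_ (insertAt w i x)
      -- The first count ignores the order of the letters, so `x` may be moved to the front, where
      -- it adds one.
      ≡⟨ cong₂ _+_ (trans (count-↭ (y >?_) (toList-insertAt-↭ w i x))
                          (count-accept (y >?_) (toList w) y>x))
                   (inversions-insertAt _>?_ min i) ⟩
    suc (k + (toℕ i + o))
      ≡⟨ cong suc (solve 3 (λ k i o → k :+ (i :+ o) := i :+ (k :+ o)) refl k (toℕ i) o) ⟩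
    suc (toℕ i + (k + o))
      ≡⟨ cong (suc (toℕ i) +_) (inversions-∷ _>?_ y w) ⟨
    suc (toℕ i) + inversions _>?_ (y ∷ w) ∎
    where
    open ≡-Reasoning
    k = count (y >?_) (toList w)
    o = inversions _>?_ w

  -- Here d colours the letters, whereas in a coloured permutation colours sit at positions.
  key : ∀ {k n} → Vec (Fin k) n → Fin n → ℕ × ℕ
  key d x = toℕ x , toℕ (lookup d x)

  zip-key : ∀ {k n m} (d : Vec (Fin k) n) (π : Vec (Fin n) m) →
    Vec.zip (Vec.map toℕ π) (Vec.map toℕ (Vec.map (lookup d) π)) ≡ Vec.map (key d) π
  zip-key d []      = refl
  zip-key d (x ∷ π) = cong (key d x ∷_) (zip-key d π)

  nonzeros : ∀ {k n} → Vec (Fin k) n → ℕ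
  nonzeros = count (λ x → 0 ℕ.<? toℕ x) ∘ toList

  -- Every letter lies below `n`, so a pair exceeds `(n , 0)` exactly when its colour is nonzero. As
  -- `π` runs once through all letters, the count over `π` is a count over `d`.
  invᶜ-map-lookup : ∀ {k n} (d : Vec (Fin k) n) {π : Vec (Fin n) n} → IsPermutation π →
    invᶜ (π , Vec.map (lookup d) π) ≡ nonzeros d + inversions (λ x y → key d x ≻? key d y) π
  invᶜ-map-lookup {n = n} d {π} π-perm = begin
    inversions _≻?_ (Vec.zip (Vec.map toℕ π) (Vec.map toℕ (Vec.map (lookup d) π)) ∷ʳ (n , 0))
      ≡⟨ cong (λ v → inversions _≻?_ (v ∷ʳ (n , 0))) (zip-key d π) ⟩
    inversions _≻?_ (Vec.map (key d) π ∷ʳ (n , 0))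
      ≡⟨ inversions-map-∷ʳ _≻?_ (key d) (n , 0) π ⟩
    count (λ x → key d x ≻? (n , 0)) (toList π) + o
      ≡⟨ cong (_+ o) (count-↭ _ (IsPermutation⇒↭ {π = π} π-perm)) ⟩
    count (λ x → key d x ≻? (n , 0)) (allFin n) + o
      ≡⟨ cong (_+ o) (count-cong _ (λ x → 0 ℕ.<? toℕ (lookup d x)) above (allFin n)) ⟩
    count (λ x → 0 ℕ.<? toℕ (lookup d x)) (allFin n) + o
      ≡⟨ cong (_+ o) (count-map (λ x → 0 ℕ.<? toℕ x) (lookup d) (allFin n)) ⟨
    count (λ x → 0 ℕ.<? toℕ x) (List.map (lookup d) (allFin n)) + o
      ≡⟨ cong (λ xs → count (λ x → 0 ℕ.<? toℕ x) xs + o) (map-lookup-allFin d) ⟩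
    nonzeros d + o ∎
    where
    open ≡-Reasoning
    o = inversions (λ x y → key d x ≻? key d y) π
    above : ∀ x → does (key d x ≻? (n , 0)) ≡ does (0 ℕ.<? toℕ (lookup d x))
    above x = does-⇔
      (mk⇔ (λ { (inj₁ 0<c)       → 0<c
              ; (inj₂ (_ , n<x)) → contradiction n<x (ℕ.<-asym (Fin.toℕ<n x)) })
           inj₁)
      (key d x ≻? (n , 0)) (0 ℕ.<? toℕ (lookup d x))

  -- The swap makes the colour the leading component of the lexicographic order.
  ≻-order : StrictTotalOrder _ _ _
  ≻-order = On.strictTotalOrder
    (×-strictTotalOrder ℕ.<-strictTotalOrder ℕ.<-strictTotalOrder) Product.swap

  ≻-arrangement : ∀ {k n} (d : Vec (Fin k) n) → ∃ λ (L : Vec (Fin n) n) → toList L ↭ allFin n ×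
    AllPairs (λ x y → key d y ≻ key d x × ¬ key d x ≻ key d y) (toList L)
  ≻-arrangement {n = n} d with L , L↭ , L↗ ← sorted-arrangement
      (On.strictTotalOrder ≻-order (key d))
      -- After the swap the second component of a key is the letter, so equal keys force equal
      -- letters.
      (Fin.toℕ-injective ∘ proj₂) (Unique.allFin⁺ n) (List.length-tabulate id)
    = L , L↭ , AllPairs.map (λ x⊏y → flip-≻ x⊏y , λ y≻x → asym x⊏y (≻-flip y≻x)) L↗
    where
    open StrictTotalOrder ≻-order using (asym) renaming (_<_ to _⊏_)
    flip-≻ : ∀ {x y} → x ⊏ y → y ≻ x
    flip-≻ (inj₁ c<c′)       = inj₁ c<c′
    flip-≻ (inj₂ (eq , a<a′)) = inj₂ (sym eq , a<a′)
    ≻-flip : ∀ {x y} → y ≻ x → x ⊏ y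
    ≻-flip (inj₁ c<c′)       = inj₁ c<c′
    ≻-flip (inj₂ (eq , a<a′)) = inj₂ (sym eq , a<a′)

  <-arrangement : ∀ n → ∃ λ (L : Vec (Fin n) n) → toList L ↭ allFin n ×
    AllPairs (λ x y → x Fin.< y × ¬ y Fin.< x) (toList L)
  <-arrangement n with L , L↭ , L↗ ← sorted-arrangement (Fin.<-strictTotalOrder n)
      id (Unique.allFin⁺ n) (List.length-tabulate id)
    = L , L↭ , AllPairs.map (λ x<y → x<y , ℕ.<-asym x<y) L↗

open Arrangements

-- Generating functions of inversions

module ListSum {c₀ ℓ₀} (R : CommutativeRing c₀ ℓ₀) where
  open CommutativeRing R hiding (zero)
  open OverRing R
  open import Algebra.Properties.Semiring.Sum semiring using (sum)
  open import Algebra.Solver.Ring.NaturalCoefficients.Default commutativeSemiring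
    using (solve; _:=_; _:+_)

  -- Finite sums over lists.

  ∑-cong : ∀ (xs : List A) {f g} → (∀ {x} → x ∈ xs → f x ≈ g x) → ∑[ xs ] f ≈ ∑[ xs ] g
  ∑-cong []       f≈g = refl
  ∑-cong (x ∷ xs) f≈g = +-cong (f≈g (here ≡.refl)) (∑-cong xs (f≈g ∘ there))

  ∑-++ : ∀ (xs ys : List A) f → ∑[ xs ++ ys ] f ≈ ∑[ xs ] f + ∑[ ys ] f
  ∑-++ []       ys f = sym (+-identityˡ _)
  ∑-++ (x ∷ xs) ys f = trans (+-congˡ (∑-++ xs ys f)) (sym (+-assoc _ _ _))

  ∑-map : ∀ (g : A → B) xs f → ∑[ List.map g xs ] f ≈ ∑[ xs ] (f ∘ g)
  ∑-map g []       f = refl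
  ∑-map g (x ∷ xs) f = +-congˡ (∑-map g xs f)

  ∑-cartesianProductWith : ∀ (g : A → B → C) xs ys f →
    ∑[ cartesianProductWith g xs ys ] f ≈ ∑[ xs ] (λ x → ∑[ ys ] (λ y → f (g x y)))
  ∑-cartesianProductWith g []       ys f = refl
  ∑-cartesianProductWith g (x ∷ xs) ys f =
    trans (∑-++ (List.map (g x) ys) (cartesianProductWith g xs ys) f)
      (+-cong (∑-map (g x) ys f) (∑-cartesianProductWith g xs ys f))

  *-distribˡ-∑ : ∀ x (xs : List A) f → x * ∑[ xs ] f ≈ ∑[ xs ] (λ y → x * f y)
  *-distribˡ-∑ x []       f = zeroʳ x
  *-distribˡ-∑ x (y ∷ xs) f = trans (distribˡ x _ _) (+-congˡ (*-distribˡ-∑ x xs f))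

  *-distribʳ-∑ : ∀ x (xs : List A) f → ∑[ xs ] f * x ≈ ∑[ xs ] (λ y → f y * x)
  *-distribʳ-∑ x []       f = zeroˡ x
  *-distribʳ-∑ x (y ∷ xs) f = trans (distribʳ x _ _) (+-congˡ (*-distribʳ-∑ x xs f))

  ∑-zero : ∀ (xs : List A) → ∑[ xs ] (λ _ → 0#) ≈ 0#
  ∑-zero []       = refl
  ∑-zero (x ∷ xs) = trans (+-identityˡ _) (∑-zero xs)

  ∑-distrib-+ : ∀ (xs : List A) f g → ∑[ xs ] (λ x → f x + g x) ≈ ∑[ xs ] f + ∑[ xs ] g
  ∑-distrib-+ []       f g = sym (+-identityˡ _)
  ∑-distrib-+ (x ∷ xs) f g = trans (+-congˡ (∑-distrib-+ xs f g))
    (solve 4 (λ a b c d → (a :+ b) :+ (c :+ d) := (a :+ c) :+ (b :+ d)) refl (f x) (g x) _ _)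

  ∑-comm : ∀ (xs : List A) (ys : List B) (f : A → B → Carrier) →
    ∑[ xs ] (λ x → ∑[ ys ] (λ y → f x y)) ≈ ∑[ ys ] (λ y → ∑[ xs ] (λ x → f x y))
  ∑-comm []       ys f = sym (∑-zero ys)
  ∑-comm (x ∷ xs) ys f = trans (+-congˡ (∑-comm xs ys f))
    (sym (∑-distrib-+ ys (f x) (λ y → ∑[ xs ] (λ x → f x y))))

  ∑-↭ : ∀ {xs ys : List A} f → xs ↭ ys → ∑[ xs ] f ≈ ∑[ ys ] f
  ∑-↭ f Perm.refl           = refl
  ∑-↭ f (Perm.prep x p)     = +-congˡ (∑-↭ f p)
  ∑-↭ f (Perm.swap x y p)   = trans (+-congˡ (+-congˡ (∑-↭ f p)))
    (solve 3 (λ a b c → a :+ (b :+ c) := b :+ (a :+ c)) refl (f x) (f y) _)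
  ∑-↭ f (Perm.trans p p′)   = trans (∑-↭ f p) (∑-↭ f p′)

  ∑-tabulate : ∀ {n} (g : Fin n → A) f → ∑[ List.tabulate g ] f ≈ sum {n} (f ∘ g)
  ∑-tabulate {n = zero}  g f = refl
  ∑-tabulate {n = suc n} g f = +-congˡ (∑-tabulate (g ∘ suc) f)

-- Inversion sums over permutations and colourings.

module InversionSums {c₀ ℓ₀} (R : CommutativeRing c₀ ℓ₀) (q : CommutativeRing.Carrier R) where
  open CommutativeRing R hiding (zero)
  open OverRing R
  open ListSum R
  open QAnalogue R q
  open import Algebra.Properties.Semiring.Exp semiring using (^-homo-*)
  open import Algebra.Properties.Semiring.Sum semiring using (sum; sum-cong-≋; sum-replicate)
  open import Relation.Binary.Reasoning.Setoid setoid

  -- Position `i` of the new least letter contributes the factor `q^i` whatever the word, and these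
  -- factors add up to `⟦ suc n ⟧`.
  ∑-arrangements : ∀ {A : Set a} {_>_ : Rel A ℓ} (_>?_ : B.Decidable _>_) {n} (L : Vec A n) →
    AllPairs (λ x y → y > x × ¬ x > y) (toList L) →
    ∑[ arrangements L ] (λ w → q ^ inversions _>?_ w) ≈ ⟦ n ⟧!
  ∑-arrangements _>?_ []      _ = +-identityʳ _
  ∑-arrangements _>?_ {suc n} (x ∷ L) (x-min ∷ L↗) = begin
    ∑[ arrangements (x ∷ L) ] (λ w → q ^ inversions _>?_ w)
      ≈⟨ ∑-cartesianProductWith (λ w i → insertAt w i x) (arrangements L) (allFin (suc n)) _ ⟩
    ∑[ arrangements L ] (λ w → ∑[ allFin (suc n) ] (λ i → q ^ inversions _>?_ (insertAt w i x)))
      ≈⟨ ∑-cong (arrangements L) insertions ⟩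
    ∑[ arrangements L ] (λ w → ⟦ suc n ⟧ * q ^ inversions _>?_ w)
      ≈⟨ *-distribˡ-∑ ⟦ suc n ⟧ (arrangements L) _ ⟨
    ⟦ suc n ⟧ * ∑[ arrangements L ] (λ w → q ^ inversions _>?_ w)
      ≈⟨ *-congˡ (∑-arrangements _>?_ L L↗) ⟩
    ⟦ suc n ⟧ * ⟦ n ⟧! ∎
    where
    insertions : ∀ {w} → w ∈ arrangements L →
      ∑[ allFin (suc n) ] (λ i → q ^ inversions _>?_ (insertAt w i x))
        ≈ ⟦ suc n ⟧ * q ^ inversions _>?_ w
    insertions {w} w∈ = begin
      ∑[ allFin (suc n) ] (λ i → q ^ inversions _>?_ (insertAt w i x))
        ≈⟨ ∑-cong (allFin (suc n)) (λ {i} _ → begin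
             q ^ inversions _>?_ (insertAt w i x)
               ≡⟨ ≡.cong (q ^_) (inversions-insertAt _>?_
                    -- `w` has the same letters as `L`, so `x` is least relative to `w` as well.
                    (All-resp-↭ (↭-sym (∈-arrangements⁻ L w∈)) x-min) i) ⟩
             q ^ (toℕ i ℕ.+ inversions _>?_ w)
               ≈⟨ ^-homo-* q (toℕ i) (inversions _>?_ w) ⟩
             q ^ toℕ i * q ^ inversions _>?_ w ∎) ⟩
      ∑[ allFin (suc n) ] (λ i → q ^ toℕ i * q ^ inversions _>?_ w)
        ≈⟨ *-distribʳ-∑ (q ^ inversions _>?_ w) (allFin (suc n)) (λ i → q ^ toℕ i) ⟨
      ∑[ allFin (suc n) ] (λ i → q ^ toℕ i) * q ^ inversions _>?_ w
        ≈⟨ *-congʳ (∑-tabulate {n = suc n} id (λ i → q ^ toℕ i)) ⟩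
      ⟦ suc n ⟧ * q ^ inversions _>?_ w ∎

  -- Stated for any relation with an increasing listing of the letters, so as to serve both the
  -- natural order and the orders induced by colourings.
  ∑-𝒮 : ∀ {n} {_>_ : Rel (Fin n) ℓ} (_>?_ : B.Decidable _>_) {L : Vec (Fin n) n} →
    toList L ↭ allFin n → AllPairs (λ x y → y > x × ¬ x > y) (toList L) →
    ∑[ 𝒮 n ] (λ π → q ^ inversions _>?_ π) ≈ ⟦ n ⟧!
  ∑-𝒮 _>?_ {L} L↭ L↗ =
    trans (∑-↭ _ (𝒮↭arrangements L↭)) (∑-arrangements _>?_ L L↗)

  ∑-inv : ∀ n → ∑[ 𝒮 n ] (λ π → q ^ inv π) ≈ ⟦ n ⟧!
  ∑-inv n with L , L↭ , L↗ ← <-arrangement n = ∑-𝒮 (λ x y → y Fin.<? x) L↭ L↗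

  -- The weight is multiplicative over entries: colour 0 contributes `1#` and each of the `k` other
  -- colours contributes `q`.
  ∑-nonzeros : ∀ k n → ∑[ words (suc k) n ] (λ d → q ^ nonzeros d) ≈ (k · q + 1#) ^ n
  ∑-nonzeros k zero    = +-identityʳ _
  ∑-nonzeros k (suc n) = begin
    ∑[ words (suc k) (suc n) ] (λ d → q ^ nonzeros d)
      ≈⟨ ∑-cartesianProductWith _∷_ (allFin (suc k)) (words (suc k) n) _ ⟩
    ∑[ allFin (suc k) ] (λ x → ∑[ words (suc k) n ] (λ d → q ^ nonzeros (x ∷ d)))
      ≈⟨ ∑-cong (allFin (suc k)) (λ {x} _ → begin
           ∑[ words (suc k) n ] (λ d → q ^ nonzeros (x ∷ d))
             ≈⟨ ∑-cong (words (suc k) n) (λ {d} _ → begin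
                  q ^ nonzeros (x ∷ d)
                    ≡⟨ ≡.cong (q ^_) (count-∷ (λ x → 0 ℕ.<? toℕ x) x (toList d)) ⟩
                  q ^ (weight x ℕ.+ nonzeros d)
                    ≈⟨ ^-homo-* q (weight x) (nonzeros d) ⟩
                  q ^ weight x * q ^ nonzeros d ∎) ⟩
           ∑[ words (suc k) n ] (λ d → q ^ weight x * q ^ nonzeros d)
             ≈⟨ *-distribˡ-∑ (q ^ weight x) (words (suc k) n) _ ⟨
           q ^ weight x * ∑[ words (suc k) n ] (λ d → q ^ nonzeros d)
             ≈⟨ *-congˡ (∑-nonzeros k n) ⟩
           q ^ weight x * (k · q + 1#) ^ n ∎) ⟩
    ∑[ allFin (suc k) ] (λ x → q ^ weight x * (k · q + 1#) ^ n)
      ≈⟨ *-distribʳ-∑ _ (allFin (suc k)) (λ x → q ^ weight x) ⟨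
    ∑[ allFin (suc k) ] (λ x → q ^ weight x) * (k · q + 1#) ^ n
      ≈⟨ *-congʳ (begin
           1# + ∑[ List.tabulate suc ] (λ x → q ^ weight x)
             ≈⟨ +-congˡ (∑-tabulate suc (λ x → q ^ weight x)) ⟩
           1# + sum {k} (λ _ → q ^ 1)
             ≈⟨ +-congˡ (sum-cong-≋ {k} (λ _ → *-identityʳ q)) ⟩
           1# + sum {k} (λ _ → q)
             ≈⟨ +-congˡ (sum-replicate k) ⟩
           1# + k · q
             ≈⟨ +-comm _ _ ⟩
           k · q + 1# ∎) ⟩
    (k · q + 1#) * (k · q + 1#) ^ n ∎
    where
    weight : Fin (suc k) → ℕ
    weight x = if does (0 ℕ.<? toℕ x) then 1 else 0

  -- Reading the colours off the letters rather than the positions leaves a permutation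
  -- of a set of letters whose order depends only on the colouring d.
  ∑-invᶜ : ∀ k n → ∑[ 𝒮ᶜ (suc k) n ] (λ P → q ^ invᶜ P) ≈ (k · q + 1#) ^ n * ⟦ n ⟧!
  ∑-invᶜ k n = begin
    ∑[ 𝒮ᶜ (suc k) n ] (λ P → q ^ invᶜ P)
      ≈⟨ ∑-cartesianProductWith _,_ (𝒮 n) W _ ⟩
    ∑[ 𝒮 n ] (λ π → ∑[ W ] (λ c → q ^ invᶜ (π , c)))
      ≈⟨ ∑-cong (𝒮 n) (λ {π} π∈ → begin
           ∑[ W ] (λ c → q ^ invᶜ (π , c))
             ≈⟨ ∑-↭ _ (map-lookup-words-↭ {π = π} (∈-𝒮⁻ π∈)) ⟨
           ∑[ List.map (λ d → Vec.map (lookup d) π) W ] (λ c → q ^ invᶜ (π , c))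
             ≈⟨ ∑-map (λ d → Vec.map (lookup d) π) W _ ⟩
           ∑[ W ] (λ d → q ^ invᶜ (π , Vec.map (lookup d) π))
             ≈⟨ ∑-cong W (λ {d} _ → begin
                  q ^ invᶜ (π , Vec.map (lookup d) π)
                    ≡⟨ ≡.cong (q ^_) (invᶜ-map-lookup d {π} (∈-𝒮⁻ π∈)) ⟩
                  q ^ (nonzeros d ℕ.+ inversions (≻ᵏ? d) π)
                    ≈⟨ ^-homo-* q (nonzeros d) _ ⟩
                  q ^ nonzeros d * q ^ inversions (≻ᵏ? d) π ∎) ⟩
           ∑[ W ] (λ d → q ^ nonzeros d * q ^ inversions (≻ᵏ? d) π) ∎) ⟩
    ∑[ 𝒮 n ] (λ π → ∑[ W ] (λ d → q ^ nonzeros d * q ^ inversions (≻ᵏ? d) π))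
      ≈⟨ ∑-comm (𝒮 n) W (λ π d → q ^ nonzeros d * q ^ inversions (≻ᵏ? d) π) ⟩
    ∑[ W ] (λ d → ∑[ 𝒮 n ] (λ π → q ^ nonzeros d * q ^ inversions (≻ᵏ? d) π))
      ≈⟨ ∑-cong W (λ {d} _ → begin
           ∑[ 𝒮 n ] (λ π → q ^ nonzeros d * q ^ inversions (≻ᵏ? d) π)
             ≈⟨ *-distribˡ-∑ (q ^ nonzeros d) (𝒮 n) _ ⟨
           q ^ nonzeros d * ∑[ 𝒮 n ] (λ π → q ^ inversions (≻ᵏ? d) π)
             ≈⟨ *-congˡ (let L , L↭ , L↗ = ≻-arrangement d in ∑-𝒮 (≻ᵏ? d) L↭ L↗) ⟩
           q ^ nonzeros d * ⟦ n ⟧! ∎) ⟩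
    ∑[ W ] (λ d → q ^ nonzeros d * ⟦ n ⟧!)
      ≈⟨ *-distribʳ-∑ ⟦ n ⟧! W _ ⟨
    ∑[ W ] (λ d → q ^ nonzeros d) * ⟦ n ⟧!
      ≈⟨ *-congʳ (∑-nonzeros k n) ⟩
    (k · q + 1#) ^ n * ⟦ n ⟧! ∎
    where
    W = words (suc k) n
    ≻ᵏ? : (d : Vec (Fin (suc k)) n) → B.Decidable (λ x y → key d x ≻ key d y)
    ≻ᵏ? d x y = key d x ≻? key d y

corollary8 : ∀ {c₀ ℓ₀} (R : CommutativeRing c₀ ℓ₀) →
    let open CommutativeRing R
        open OverRing R
    in (q : Carrier) →
      (𝒞 (inversionParameters q) ≐ λ n → ∑[ 𝒮 n ] λ π → q ^ inv π)
      × (∀ (k : ℕ) → 1 < k →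
          dilate ((k ∸ 1) · q + 1#) (𝒞 (inversionParameters q))
            ≐ λ n → ∑[ 𝒮ᶜ k n ] λ P → q ^ invᶜ P)
corollary8 R q =
  (λ n → trans (𝒞≈factorial n) (sym (∑-inv n))) ,
  -- With `suc k` colours, `suc k ∸ 1` computes to `k`, the number of nonzero colours.
  λ { (suc k) _ n → trans (*-congˡ (𝒞≈factorial n)) (sym (∑-invᶜ k n)) }
  where
  open CommutativeRing R using (*-congˡ; trans; sym)
  open QAnalogue R q
  open InversionSums R q
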